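{- Let $0<\varepsilon\le\frac1{24}$, let $n,k$ be positive integers with $n\ge k/\varepsilon$, and let $\mathcal F\subset\binom{[n]}{k}$ be an intersecting family with $|\mathcal F|\ge 36\binom{n-3}{k-3}$. Then $\varrho(\mathcal F)>\frac23-\varepsilon$.
   Context: $[n]=\{1,\dots,n\}$; $\binom{[n]}{k}$ is the set of $k$-subsets of $[n]$. $\mathcal F$ is intersecting if $F\cap F'\ne\emptyset$ for all $F,F'\in\mathcal F$. For $i\in[n]$, $\mathcal F(i)=\{F\setminus\{i\}: i\in F\in\mathcal F\}$, and $\varrho(\mathcal F)=\max_{i\in[n]}|\mathcal F(i)|/|\mathcal F|$. Binomial coefficients $\binom{m}{j}$ are $0$ when $j<0$ or $j>m$. -}

module Defs where

open import Data.Nat using (ℕ; zero; suc)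
open import Data.Nat.Combinatorics using (_C_)
open import Data.Fin using (Fin)
open import Data.Fin.Subset using (Subset; _∩_; ∣_∣; Nonempty; _∈_)
open import Data.Fin.Subset.Properties using (_∈?_)
open import Data.List using (List; length; filter)
open import Data.List.Relation.Unary.All using (All)
open import Data.List.Membership.Propositional renaming (_∈_ to _∈ₗ_)
open import Data.Integer using (+_)
open import Data.Rational using (ℚ; _/_)

toℚ : ℕ → ℚ
toℚ m = (+ m) / 1

-- binom(n-3, k-3) with the convention binom(m,j) = 0 when j < 0 or j > m
-- (m = n-3, j = k-3 as integers).
binom3 : ℕ → ℕ → ℕ
binom3 (suc (suc (suc n))) (suc (suc (suc k))) = n C k
binom3 _ _ = 0

-- A family F ⊆ ([n] choose k), represented as a list of subsets of Fin n
-- (duplicate-freeness is imposed separately in the statement).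
Uniform : {n : ℕ} → ℕ → List (Subset n) → Set
Uniform k F = All (λ A → ∣ A ∣ ≡ k) F
  where open import Relation.Binary.PropositionalEquality using (_≡_)

Intersecting : {n : ℕ} → List (Subset n) → Set
Intersecting F = ∀ {A B} → A ∈ₗ F → B ∈ₗ F → Nonempty (A ∩ B)

degree : {n : ℕ} → List (Subset n) → Fin n → ℕ
degree F i = length (filter (i ∈?_) F)

{-# OPTIONS --safe #-}

-- Write t = C(n-3,k-3), q = C(n-3,k-4), N = |F|, so that 23 q ≤ t, 36 t ≤ N and 8 q n < 3 k N.  By the
-- last of these it suffices to refute that 3 d(x) + 8 q < 2 N for all degrees d(x).
--
-- Let two families on the same ground set be cross-intersecting.  After shifting both, if some
-- member of one has few elements in every initial segment then all members of the other have many
-- in some initial segment, and the reflection principle counts those.  So a family of members with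
-- a given trace bounds the family with any disjoint trace once it has more than t, 2 t or 3 t sets.
-- It follows that no two disjoint pairs of points have codegree > 4 t (are heavy), and that heavy
-- pairs {a,b}, {a,c} make either {a,b,c} a triangle that nearly all members meet twice, or a a point
-- of nearly all members; both contradict the assumption on the degrees.
--
-- Now shift F as long as the assumption on the degrees survives.  In the final family each pair i < j
-- is either stable or bad, that is, at most (N + 8 q) / 3 members avoid both points.  Disjoint bad
-- pairs are joined by a heavy pair, so at most two bad pairs are pairwise disjoint; outside their
-- union F is stable, and comparing the traces on it yields two intersecting heavy pairs again.

module Submission where

-- A nested scope, since < and ≤ are those of ℕ in the proof but those of ℚ in the theorem.
module RelativeDegree where

  open import Defs
  open import Data.Bool using (Bool; true; false; _∧_; _∨_; not; T; if_then_else_)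
  open import Data.Bool.Properties using (∧-comm; ∧-assoc; T-≡) renaming (_≟_ to _≟ᵇ_)
  open import Data.Empty using (⊥; ⊥-elim)
  open import Data.Fin using (Fin; zero; suc; punchIn; punchOut; _↑ˡ_; _↑ʳ_)
  import Data.Fin as Fin
  open import Data.Fin.Patterns using (0F; 1F; 2F; 3F; 4F)
  open import Data.Fin.Properties using (punchIn-punchOut; punchIn-injective; punchInᵢ≢i; punchIn-mono-≤) renaming (_≟_ to _≟ᶠ_)
  import Data.Fin.Properties as Finₚ
  open import Data.Fin.Subset using (Subset; ∣_∣; Nonempty; _∩_)
  open import Data.Fin.Subset.Properties using (x∈p∩q⁻) renaming (_∈?_ to _∈ₛ?_)
  open import Data.List using (List; []; _∷_; length; filter)
  open import Data.List.Membership.Propositional using (_∈_)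
  open import Data.List.Membership.Propositional.Properties using (∈-filter⁺; ∈-filter⁻)
  open import Data.List.Relation.Unary.All using (All; []; _∷_)
  import Data.List.Relation.Unary.All as All
  open import Data.List.Relation.Unary.AllPairs using ([]; _∷_)
  open import Data.List.Relation.Unary.Any using (here; there; any?)
  open import Data.List.Relation.Unary.Unique.Propositional using (Unique)
  open import Data.List.Relation.Unary.Unique.Propositional.Properties using (filter⁺)
  open import Data.Nat hiding (_/_)
  open import Data.Nat.Induction using (<-wellFounded)
  open import Data.Nat.Properties
  open import Data.Nat.Tactic.RingSolver using (solve-∀)
  open import Data.Product using (∃; Σ; _×_; _,_; proj₁; proj₂)
  open import Data.Sum using (_⊎_; inj₁; inj₂; [_,_]′; map)
  open import Data.Unit using (tt)
  open import Data.Vec using (Vec; []; _∷_; lookup; insertAt; removeAt; _[_]≔_; _++_)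
  open import Data.Vec.Properties using (insertAt-lookup; insertAt-punchIn; insertAt-removeAt; lookup∘update; lookup∘update′; tabulate∘lookup; tabulate-cong; lookup-++ʳ; []=⇒lookup; lookup⇒[]=; ≡-dec)
  open import Function using (_∘_; case_of_)
  open import Function.Bundles using (Equivalence)
  open import Induction.WellFounded using (Acc; acc)
  open import Relation.Binary.PropositionalEquality using (_≡_; _≢_; refl; sym; trans; cong; cong₂; subst; subst₂; ≢-sym)
  open import Relation.Nullary using (Dec; yes; no; ¬_; does)
  open import Relation.Nullary.Decidable using (True; toWitness; _×-dec_; ¬?; dec-true)

  private
    variable
      n p v : ℕ

  -- Linear arithmetic

  data Lin (v : ℕ) : Set where
    con : ℕ → Lin v
    var : Fin v → Lin v
    _⊕_ : Lin v → Lin v → Lin v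
    _⊗_ : ℕ → Lin v → Lin v

  infixl 6 _⊕_
  infixl 7 _⊗_

  ⟦_⟧ : Lin v → Vec ℕ v → ℕ
  ⟦ con c ⟧ ρ = c
  ⟦ var x ⟧ ρ = lookup ρ x
  ⟦ e ⊕ f ⟧ ρ = ⟦ e ⟧ ρ + ⟦ f ⟧ ρ
  ⟦ c ⊗ e ⟧ ρ = c * ⟦ e ⟧ ρ

  constant : Lin v → ℕ
  constant (con c) = c
  constant (var x) = 0
  constant (e ⊕ f) = constant e + constant f
  constant (c ⊗ e) = c * constant e

  unit : Fin v → Fin v → ℕ
  unit zero    zero    = 1
  unit zero    (suc y) = 0
  unit (suc x) zero    = 0
  unit (suc x) (suc y) = unit x y

  coeff : Lin v → Fin v → ℕ
  coeff (con c) y = 0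
  coeff (var x) y = unit x y
  coeff (e ⊕ f) y = coeff e y + coeff f y
  coeff (c ⊗ e) y = c * coeff e y

  dot : (Fin v → ℕ) → Vec ℕ v → ℕ
  dot f []      = 0
  dot f (r ∷ ρ) = f zero * r + dot (f ∘ suc) ρ

  dot-0 : (ρ : Vec ℕ v) → dot (λ _ → 0) ρ ≡ 0
  dot-0 []      = refl
  dot-0 (r ∷ ρ) = dot-0 ρ

  dot-unit : (x : Fin v) (ρ : Vec ℕ v) → dot (unit x) ρ ≡ lookup ρ x
  dot-unit zero    (r ∷ ρ) = trans (cong₂ _+_ (*-identityˡ r) (dot-0 ρ)) (+-identityʳ r)
  dot-unit (suc x) (r ∷ ρ) = dot-unit x ρ

  dot-+ : (f g : Fin v → ℕ) (ρ : Vec ℕ v) → dot (λ y → f y + g y) ρ ≡ dot f ρ + dot g ρ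
  dot-+ f g []      = refl
  dot-+ f g (r ∷ ρ) = trans (cong ((f zero + g zero) * r +_) (dot-+ (f ∘ suc) (g ∘ suc) ρ))
    (lemma (f zero) (g zero) r (dot (f ∘ suc) ρ) (dot (g ∘ suc) ρ))
    where
    lemma : ∀ a b r x y → (a + b) * r + (x + y) ≡ (a * r + x) + (b * r + y)
    lemma = solve-∀

  dot-* : (c : ℕ) (f : Fin v → ℕ) (ρ : Vec ℕ v) → dot (λ y → c * f y) ρ ≡ c * dot f ρ
  dot-* c f []      = sym (*-zeroʳ c)
  dot-* c f (r ∷ ρ) = trans (cong (c * f zero * r +_) (dot-* c (f ∘ suc) ρ))
    (lemma c (f zero) r (dot (f ∘ suc) ρ))
    where
    lemma : ∀ c a r x → c * a * r + c * x ≡ c * (a * r + x)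
    lemma = solve-∀

  dot-mono : (f g : Fin v → ℕ) (ρ : Vec ℕ v) → (∀ y → f y ≤ g y) → dot f ρ ≤ dot g ρ
  dot-mono f g []      f≤g = z≤n
  dot-mono f g (r ∷ ρ) f≤g =
    +-mono-≤ (*-monoˡ-≤ r (f≤g zero)) (dot-mono (f ∘ suc) (g ∘ suc) ρ (f≤g ∘ suc))

  normal-form : (e : Lin v) (ρ : Vec ℕ v) → ⟦ e ⟧ ρ ≡ constant e + dot (coeff e) ρ
  normal-form (con c) ρ = sym (trans (cong (c +_) (dot-0 ρ)) (+-identityʳ c))
  normal-form (var x) ρ = sym (dot-unit x ρ)
  normal-form (e ⊕ f) ρ = trans (cong₂ _+_ (normal-form e ρ) (normal-form f ρ))
    (trans (lemma (constant e) (constant f) (dot (coeff e) ρ) (dot (coeff f) ρ))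
      (cong (constant e + constant f +_) (sym (dot-+ (coeff e) (coeff f) ρ))))
    where
    lemma : ∀ a b x y → (a + x) + (b + y) ≡ a + b + (x + y)
    lemma = solve-∀
  normal-form (c ⊗ e) ρ = trans (cong (c *_) (normal-form e ρ))
    (trans (*-distribˡ-+ c (constant e) _) (cong (c * constant e +_) (sym (dot-* c (coeff e) ρ))))

  infix 4 _·_⩽_

  data Inequality (v : ℕ) : Set where
    _·_⩽_ : ℕ → Lin v → Lin v → Inequality v

  Holds : Vec ℕ v → Inequality v → Set
  Holds ρ (_ · e ⩽ f) = ⟦ e ⟧ ρ ≤ ⟦ f ⟧ ρ

  lower upper : List (Inequality v) → Lin v
  lower []                 = con 0
  lower ((c · e ⩽ f) ∷ hs) = c ⊗ e ⊕ lower hs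
  upper []                 = con 0
  upper ((c · e ⩽ f) ∷ hs) = c ⊗ f ⊕ upper hs

  combine : (ρ : Vec ℕ v) (hs : List (Inequality v)) → All (Holds ρ) hs → ⟦ lower hs ⟧ ρ ≤ ⟦ upper hs ⟧ ρ
  combine ρ []                 []       = z≤n
  combine ρ ((c · e ⩽ f) ∷ hs) (h ∷ ps) = +-mono-≤ (*-monoʳ-≤ c h) (combine ρ hs ps)

  -- Both conditions are decided by evaluation, so `tt , tt` checks a certificate. Comparing
  -- coefficients by `≤` suffices because the variables are natural numbers. A strict inequality is
  -- entered with `con 1` on its left side.
  Refutes : List (Inequality v) → Set
  Refutes hs = True (constant (upper hs) <? constant (lower hs))
             × True (Finₚ.all? (λ y → coeff (upper hs) y ≤? coeff (lower hs) y))

  -- The multipliers carried by the inequalities are a Farkas certificate.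
  farkas : (ρ : Vec ℕ v) (hs : List (Inequality v)) → Refutes hs → All (Holds ρ) hs → ⊥
  farkas ρ hs (c< , f≤) ps = <-irrefl refl (≤-trans strict (combine ρ hs ps))
    where
    strict : ⟦ upper hs ⟧ ρ < ⟦ lower hs ⟧ ρ
    strict rewrite normal-form (upper hs) ρ | normal-form (lower hs) ρ =
      +-mono-<-≤ (toWitness c<) (dot-mono (coeff (upper hs)) (coeff (lower hs)) ρ (toWitness f≤))

  -- Sums over all subsets

  total : (Subset n → ℕ) → ℕ
  total {zero}  f = f []
  total {suc n} f = total (f ∘ (true ∷_)) + total (f ∘ (false ∷_))

  total-cong : {f g : Subset n → ℕ} → (∀ A → f A ≡ g A) → total f ≡ total g
  total-cong {zero}  eq = eq []
  total-cong {suc n} eq = cong₂ _+_ (total-cong (eq ∘ (true ∷_))) (total-cong (eq ∘ (false ∷_)))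

  total-mono : {f g : Subset n → ℕ} → (∀ A → f A ≤ g A) → total f ≤ total g
  total-mono {zero}  le = le []
  total-mono {suc n} le = +-mono-≤ (total-mono (le ∘ (true ∷_))) (total-mono (le ∘ (false ∷_)))

  interchange : ∀ a b c d → (a + b) + (c + d) ≡ (a + c) + (b + d)
  interchange = solve-∀

  total-+ : (f g : Subset n → ℕ) → total (λ A → f A + g A) ≡ total f + total g
  total-+ {zero}  f g = refl
  total-+ {suc n} f g = trans (cong₂ _+_ (total-+ (f ∘ (true ∷_)) (g ∘ (true ∷_))) (total-+ (f ∘ (false ∷_)) (g ∘ (false ∷_))))
    (interchange (total (f ∘ (true ∷_))) _ _ _)

  total-0 : total {n} (λ _ → 0) ≡ 0
  total-0 {zero}  = refl
  total-0 {suc n} = cong₂ _+_ (total-0 {n}) (total-0 {n})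

  -- Serves to turn a potential that a shift does not lower into an equality at every single set.
  total-tight : {f g : Subset n → ℕ} → (∀ A → f A ≤ g A) → total g ≤ total f → ∀ A → f A ≡ g A
  total-tight {zero}  le ge [] = ≤-antisym (le []) ge
  total-tight {suc n} {f} {g} le ge (b ∷ A) = go b
    where
    le₁ = total-mono (le ∘ (true ∷_))
    le₀ = total-mono (le ∘ (false ∷_))
    go : ∀ b → f (b ∷ A) ≡ g (b ∷ A)
    go true  = total-tight (le ∘ (true ∷_))
      (+-cancelʳ-≤ _ _ _ (≤-trans ge (+-monoʳ-≤ (total (f ∘ (true ∷_))) le₀))) A
    go false = total-tight (le ∘ (false ∷_))
      (+-cancelˡ-≤ _ _ _ (≤-trans ge (+-monoˡ-≤ (total (f ∘ (false ∷_))) le₁))) A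

  total-insertAt : (x : Fin (suc n)) (f : Subset (suc n) → ℕ) →
    total (λ A → f (insertAt A x true)) + total (λ A → f (insertAt A x false)) ≡ total f
  total-insertAt         zero    f = refl
  total-insertAt {suc n} (suc x) f = trans
    (interchange (total (λ A → f (true ∷ insertAt A x true))) _ _ _)
    (cong₂ _+_ (total-insertAt x (f ∘ (true ∷_))) (total-insertAt x (f ∘ (false ∷_))))

  Family : ℕ → Set
  Family n = Subset n → Bool

  indicator : Bool → ℕ
  indicator true  = 1
  indicator false = 0

  indicator-mono : {b c : Bool} → (b ≡ true → c ≡ true) → indicator b ≤ indicator c
  indicator-mono {true}  {true}  h = ≤-refl
  indicator-mono {true}  {false} h = case h refl of λ ()
  indicator-mono {false}         h = z≤n

  size : Family n → ℕ
  size F = total (indicator ∘ F)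

  size-mono : {F G : Family n} → (∀ A → F A ≡ true → G A ≡ true) → size F ≤ size G
  size-mono h = total-mono (λ A → indicator-mono (h A))

  size-cong : {F G : Family n} → (∀ A → F A ≡ G A) → size F ≡ size G
  size-cong h = total-cong (λ A → cong indicator (h A))

  size-split : (P F : Family n) → size F ≡ size (λ A → P A ∧ F A) + size (λ A → not (P A) ∧ F A)
  size-split P F = trans (total-cong (λ A → lemma (P A) (F A)))
    (total-+ (λ A → indicator (P A ∧ F A)) (λ A → indicator (not (P A) ∧ F A)))
    where
    lemma : ∀ b c → indicator c ≡ indicator (b ∧ c) + indicator (not b ∧ c)
    lemma true  c = sym (+-identityʳ _)
    lemma false c = refl

  search : (F : Family n) → (∃ λ A → F A ≡ true) ⊎ (∀ A → F A ≡ false)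
  search {zero} F with F [] in eq
  ... | true  = inj₁ ([] , eq)
  ... | false = inj₂ λ { [] → eq }
  search {suc n} F with search (F ∘ (true ∷_)) | search (F ∘ (false ∷_))
  ... | inj₁ (A , p) | _            = inj₁ (true ∷ A , p)
  ... | inj₂ _       | inj₁ (A , p) = inj₁ (false ∷ A , p)
  ... | inj₂ f       | inj₂ g       = inj₂ λ { (true ∷ A) → f A ; (false ∷ A) → g A }

  -- Relabelling the ground set

  lookup-ext : {A B : Subset n} → (∀ x → lookup A x ≡ lookup B x) → A ≡ B
  lookup-ext {A = A} {B} eq = trans (sym (tabulate∘lookup A)) (trans (tabulate-cong eq) (tabulate∘lookup B))

  -- p distinct points of Fin n, each given by its index among the points that remain.
  data Selection : ℕ → ℕ → Set where
    []  : Selection 0 n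
    _∷_ : Fin (suc n) → Selection p n → Selection (suc p) (suc n)

  position : Selection p n → Fin n → Fin n
  position []      j       = j
  position (x ∷ s) zero    = x
  position (x ∷ s) (suc j) = punchIn x (position s j)

  arrange : Selection p n → Subset n → Subset n
  arrange []      A       = A
  arrange (x ∷ s) (b ∷ A) = insertAt (arrange s A) x b

  lookup-arrange : (s : Selection p n) (A : Subset n) (j : Fin n) →
    lookup (arrange s A) (position s j) ≡ lookup A j
  lookup-arrange []      A       j       = refl
  lookup-arrange (x ∷ s) (b ∷ A) zero    = insertAt-lookup (arrange s A) x b
  lookup-arrange (x ∷ s) (b ∷ A) (suc j) =
    trans (insertAt-punchIn (arrange s A) x b (position s j)) (lookup-arrange s A j)

  position-injective : (s : Selection p n) {i j : Fin n} → position s i ≡ position s j → i ≡ j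
  position-injective []      eq = eq
  position-injective (x ∷ s) {zero}  {zero}  eq = refl
  position-injective (x ∷ s) {zero}  {suc j} eq = ⊥-elim (punchInᵢ≢i x _ (sym eq))
  position-injective (x ∷ s) {suc i} {zero}  eq = ⊥-elim (punchInᵢ≢i x _ eq)
  position-injective (x ∷ s) {suc i} {suc j} eq = cong suc (position-injective s (punchIn-injective x _ _ eq))

  position-surjective : (s : Selection p n) (i : Fin n) → ∃ λ j → position s j ≡ i
  position-surjective []      i = i , refl
  position-surjective (x ∷ s) i with x ≟ᶠ i
  ... | yes eq = zero , eq
  ... | no  ne with position-surjective s (punchOut ne)
  ...   | j , eq = suc j , trans (cong (punchIn x) eq) (punchIn-punchOut ne)

  -- The points that are not selected keep their order, so stability, which speaks of `i < j`,
  -- survives the relabelling outside the selection.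
  position-mono-< : (s : Selection p n) {i j : Fin n} → p ≤ Fin.toℕ i → i Fin.< j → position s i Fin.< position s j
  position-mono-< []      _ lt = lt
  position-mono-< (x ∷ s) {suc i} {suc j} (s≤s p≤i) (s≤s lt) =
    Finₚ.≤∧≢⇒< (punchIn-mono-≤ x _ _ (<⇒≤ lt′)) (λ eq → Finₚ.<⇒≢ lt′ (punchIn-injective x _ _ eq))
    where lt′ = position-mono-< s p≤i lt

  arrange-surjective : (s : Selection p n) (A : Subset n) → ∃ λ B → arrange s B ≡ A
  arrange-surjective []      A = A , refl
  arrange-surjective (x ∷ s) A with arrange-surjective s (removeAt A x)
  ... | B , eq = lookup A x ∷ B , trans (cong (λ C → insertAt C x (lookup A x)) eq) (insertAt-removeAt A x)

  total-arrange : (s : Selection p n) (f : Subset n → ℕ) → total (f ∘ arrange s) ≡ total f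
  total-arrange []      f = refl
  total-arrange (x ∷ s) f = trans
    (cong₂ _+_ (total-arrange s (λ A → f (insertAt A x true))) (total-arrange s (λ A → f (insertAt A x false))))
    (total-insertAt x f)

  ∣insertAt∣ : (A : Subset n) (x : Fin (suc n)) (b : Bool) → ∣ insertAt A x b ∣ ≡ ∣ b ∷ A ∣
  ∣insertAt∣ A           zero    b     = refl
  ∣insertAt∣ (true ∷ A)  (suc x) true  = cong suc (∣insertAt∣ A x true)
  ∣insertAt∣ (true ∷ A)  (suc x) false = cong suc (∣insertAt∣ A x false)
  ∣insertAt∣ (false ∷ A) (suc x) true  = ∣insertAt∣ A x true
  ∣insertAt∣ (false ∷ A) (suc x) false = ∣insertAt∣ A x false

  ∣arrange∣ : (s : Selection p n) (A : Subset n) → ∣ arrange s A ∣ ≡ ∣ A ∣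
  ∣arrange∣ []      A           = refl
  ∣arrange∣ (x ∷ s) (true ∷ A)  = trans (∣insertAt∣ (arrange s A) x true) (cong suc (∣arrange∣ s A))
  ∣arrange∣ (x ∷ s) (false ∷ A) = trans (∣insertAt∣ (arrange s A) x false) (∣arrange∣ s A)

  select₂ : {x y : Fin (2 + n)} → x ≢ y →
    Σ (Selection 2 (2 + n)) λ s → position s zero ≡ x × position s (suc zero) ≡ y
  select₂ {x = x} x≢y = x ∷ punchOut x≢y ∷ [] , refl , punchIn-punchOut x≢y

  punchOut-distinct : {x y z : Fin (suc n)} (x≢y : x ≢ y) (x≢z : x ≢ z) → y ≢ z → punchOut x≢y ≢ punchOut x≢z
  punchOut-distinct x≢y x≢z y≢z eq = y≢z (Finₚ.punchOut-injective x≢y x≢z eq)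

  select₃ : {x y z : Fin (3 + n)} → x ≢ y → x ≢ z → y ≢ z →
    Σ (Selection 3 (3 + n)) λ s → position s zero ≡ x × position s (suc zero) ≡ y × position s (suc (suc zero)) ≡ z
  select₃ {x = x} x≢y x≢z y≢z with select₂ (punchOut-distinct x≢y x≢z y≢z)
  ... | s , e₀ , e₁ = x ∷ s , refl , trans (cong (punchIn x) e₀) (punchIn-punchOut x≢y)
                    , trans (cong (punchIn x) e₁) (punchIn-punchOut x≢z)

  select₄ : {x y z w : Fin (4 + n)} → x ≢ y → x ≢ z → x ≢ w → y ≢ z → y ≢ w → z ≢ w →
    Σ (Selection 4 (4 + n)) λ s → position s zero ≡ x × position s (suc zero) ≡ y
      × position s (suc (suc zero)) ≡ z × position s (suc (suc (suc zero))) ≡ w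
  select₄ {x = x} x≢y x≢z x≢w y≢z y≢w z≢w
    with select₃ (punchOut-distinct x≢y x≢z y≢z) (punchOut-distinct x≢y x≢w y≢w) (punchOut-distinct x≢z x≢w z≢w)
  ... | s , e₀ , e₁ , e₂ = x ∷ s , refl , trans (cong (punchIn x) e₀) (punchIn-punchOut x≢y)
                    , trans (cong (punchIn x) e₁) (punchIn-punchOut x≢z)
                    , trans (cong (punchIn x) e₂) (punchIn-punchOut x≢w)

  swap : Fin n → Fin n → Subset n → Subset n
  swap i j A = A [ i ]≔ lookup A j [ j ]≔ lookup A i

  lookup-swapʳ : (i j : Fin n) (A : Subset n) → lookup (swap i j A) j ≡ lookup A i
  lookup-swapʳ i j A = lookup∘update j (A [ i ]≔ lookup A j) (lookup A i)

  lookup-swapˡ : {i j : Fin n} → i ≢ j → (A : Subset n) → lookup (swap i j A) i ≡ lookup A j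
  lookup-swapˡ {i = i} {j} i≢j A =
    trans (lookup∘update′ i≢j (A [ i ]≔ lookup A j) (lookup A i)) (lookup∘update i A (lookup A j))

  lookup-swap : {i j x : Fin n} → x ≢ i → x ≢ j → (A : Subset n) → lookup (swap i j A) x ≡ lookup A x
  lookup-swap {i = i} {j} x≢i x≢j A =
    trans (lookup∘update′ x≢j (A [ i ]≔ lookup A j) (lookup A i)) (lookup∘update′ x≢i A (lookup A j))

  swap-unique : {i j : Fin n} {A B : Subset n} → lookup B i ≡ lookup A j → lookup B j ≡ lookup A i →
    (∀ x → x ≢ i → x ≢ j → lookup B x ≡ lookup A x) → i ≢ j → B ≡ swap i j A
  swap-unique {i = i} {j} {A} {B} ei ej ex i≢j = lookup-ext go
    where
    go : ∀ x → lookup B x ≡ lookup (swap i j A) x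
    go x with x ≟ᶠ i
    ... | yes refl = trans ei (sym (lookup-swapˡ i≢j A))
    ... | no x≢i with x ≟ᶠ j
    ...   | yes refl = trans ej (sym (lookup-swapʳ i j A))
    ...   | no x≢j   = trans (ex x x≢i x≢j) (sym (lookup-swap x≢i x≢j A))

  swap-involutive : {i j : Fin n} → i ≢ j → (A : Subset n) → swap i j (swap i j A) ≡ A
  swap-involutive {i = i} {j} i≢j A = sym (swap-unique
    (sym (lookup-swapʳ i j A)) (sym (lookup-swapˡ i≢j A))
    (λ x x≢i x≢j → sym (lookup-swap x≢i x≢j A)) i≢j)

  arrange-swap : (s : Selection p n) {i j : Fin n} → i ≢ j → (A : Subset n) →
    arrange s (swap i j A) ≡ swap (position s i) (position s j) (arrange s A)
  arrange-swap s {i} {j} i≢j A = swap-unique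
    (trans (lookup-arrange s _ i) (trans (lookup-swapˡ i≢j A) (sym (lookup-arrange s A j))))
    (trans (lookup-arrange s _ j) (trans (lookup-swapʳ i j A) (sym (lookup-arrange s A i))))
    other
    (i≢j ∘ position-injective s)
    where
    other : ∀ x → x ≢ position s i → x ≢ position s j → lookup (arrange s (swap i j A)) x ≡ lookup (arrange s A) x
    other x x≢i x≢j with position-surjective s x
    ... | y , refl = trans (lookup-arrange s _ y) (trans
      (lookup-swap (x≢i ∘ cong (position s)) (x≢j ∘ cong (position s)) A) (sym (lookup-arrange s A y)))

  total-swap : {i j : Fin n} → i ≢ j → (f : Subset n → ℕ) → total (f ∘ swap i j) ≡ total f
  total-swap {suc zero}    {zero} {zero} i≢j f = ⊥-elim (i≢j refl)
  total-swap {suc (suc m)} i≢j f with select₂ i≢j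
  ... | s , refl , refl = trans (sym (total-arrange s (f ∘ swap _ _)))
    (trans (total-cong (λ A → cong f (sym (arrange-swap s {zero} {suc zero} (λ ()) A))))
    (trans (exchange (f ∘ arrange s)) (total-arrange s f)))
    where
    exchange : (g : Subset (2 + m) → ℕ) → total (g ∘ swap zero (suc zero)) ≡ total g
    exchange g = interchange (total (λ A → g (true ∷ true ∷ A))) _ _ _

  ∣swap∣ : {i j : Fin n} → i ≢ j → (A : Subset n) → ∣ swap i j A ∣ ≡ ∣ A ∣
  ∣swap∣ {suc zero}    {zero} {zero} i≢j A = ⊥-elim (i≢j refl)
  ∣swap∣ {suc (suc m)} i≢j A with select₂ i≢j
  ... | s , refl , refl with arrange-surjective s A
  ...   | B , refl = trans (cong ∣_∣ (sym (arrange-swap s {zero} {suc zero} (λ ()) B)))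
    (trans (∣arrange∣ s _) (trans (exchange B) (sym (∣arrange∣ s B))))
    where
    exchange : (B : Subset (2 + m)) → ∣ swap zero (suc zero) B ∣ ≡ ∣ B ∣
    exchange (true  ∷ true  ∷ B) = refl
    exchange (true  ∷ false ∷ B) = refl
    exchange (false ∷ true  ∷ B) = refl
    exchange (false ∷ false ∷ B) = refl

  -- Shifting

  -- Two sets that differ by exchanging `j` for `i` compete: the one with `i` is in the shifted
  -- family if either was in `F`, the one with `j` only if both were. Sets with both points or
  -- neither keep their status.
  compress : Bool → Bool → Bool → Bool → Bool
  compress true  false f f′ = f ∨ f′
  compress false true  f f′ = f ∧ f′
  compress true  true  f f′ = f
  compress false false f f′ = f

  shift : Fin n → Fin n → Family n → Family n
  shift i j F A = compress (lookup A i) (lookup A j) (F A) (F (swap i j A))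

  shift-swap : {i j : Fin n} → i ≢ j → (F : Family n) (A : Subset n) →
    shift i j F (swap i j A) ≡ compress (lookup A j) (lookup A i) (F (swap i j A)) (F A)
  shift-swap {i = i} {j} i≢j F A = trans
    (cong₂ (λ a b → compress a b (F A′) (F (swap i j A′))) (lookup-swapˡ i≢j A) (lookup-swapʳ i j A))
    (cong (λ B → compress (lookup A j) (lookup A i) (F A′) (F B)) (swap-involutive i≢j A))
    where A′ = swap i j A

  +-double-cancel-≤ : {a b : ℕ} → a + a ≤ b + b → a ≤ b
  +-double-cancel-≤ {a} {b} le with a ≤? b
  ... | yes a≤b = a≤b
  ... | no  a≰b = ⊥-elim (<⇒≱ (+-mono-< (≰⇒> a≰b) (≰⇒> a≰b)) le)

  total-double : {i j : Fin n} → i ≢ j → (f : Subset n → ℕ) → total (λ A → f A + f (swap i j A)) ≡ total f + total f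
  total-double i≢j f = trans (total-+ f (f ∘ swap _ _)) (cong (total f +_) (total-swap i≢j f))

  -- A transposition permutes the subsets, so summing over the pairs counts each total twice.
  total-≤-by-pairs : {i j : Fin n} → i ≢ j → {f g : Subset n → ℕ} →
    (∀ A → f A + f (swap i j A) ≤ g A + g (swap i j A)) → total f ≤ total g
  total-≤-by-pairs i≢j {f} {g} le = +-double-cancel-≤
    (subst₂ _≤_ (total-double i≢j f) (total-double i≢j g) (total-mono le))

  shift-pair : {i j : Fin n} → i ≢ j → (F : Family n) (A : Subset n) →
    indicator (shift i j F A) + indicator (shift i j F (swap i j A)) ≡ indicator (F A) + indicator (F (swap i j A))
  shift-pair {i = i} {j} i≢j F A = trans
    (cong (λ b → indicator (shift i j F A) + indicator b) (shift-swap i≢j F A))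
    (go (lookup A i) (lookup A j) (F A) (F (swap i j A)))
    where
    go : ∀ a b f f′ → indicator (compress a b f f′) + indicator (compress b a f′ f) ≡ indicator f + indicator f′
    go true  true  f     f′    = refl
    go false false f     f′    = refl
    go true  false true  true  = refl
    go true  false true  false = refl
    go true  false false true  = refl
    go true  false false false = refl
    go false true  true  true  = refl
    go false true  true  false = refl
    go false true  false true  = refl
    go false true  false false = refl

  size-shift : {i j : Fin n} → i ≢ j → (F : Family n) → size (shift i j F) ≡ size F
  size-shift i≢j F = ≤-antisym
    (total-≤-by-pairs i≢j (λ A → ≤-reflexive (shift-pair i≢j F A)))
    (total-≤-by-pairs i≢j (λ A → ≤-reflexive (sym (shift-pair i≢j F A))))

  -- Elements are binary digits, the first point being the least significant. Moving an element to
  -- an earlier point lowers the number, which makes `potential` a termination measure for shifting.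
  value : Subset n → ℕ
  value []      = 0
  value (b ∷ A) = indicator b + 2 * value A

  value-remove : (A : Subset n) (j : Fin n) → lookup A j ≡ true → value (A [ j ]≔ false) < value A
  value-remove (true ∷ A) zero    refl = ≤-refl
  value-remove (b ∷ A)    (suc j) eq   = +-monoʳ-< (indicator b) (*-monoʳ-< 2 (value-remove A j eq))

  value-swap : {i j : Fin n} (A : Subset n) → i Fin.< j → lookup A i ≡ false → lookup A j ≡ true →
    value (swap i j A) < value A
  value-swap {i = zero}  {suc j} (false ∷ A) _ refl eq rewrite eq =
    ≤-trans (≤-reflexive (lemma (value (A [ j ]≔ false)))) (*-monoʳ-≤ 2 (value-remove A j eq))
    where
    lemma : ∀ x → suc (suc (2 * x)) ≡ 2 * suc x
    lemma = solve-∀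
  value-swap {i = suc i} {suc j} (b ∷ A) (s≤s lt) ei ej = +-monoʳ-< (indicator b) (*-monoʳ-< 2 (value-swap A lt ei ej))

  potential : Family n → ℕ
  potential F = total (λ A → indicator (F A) * value A)

  StableAt : Fin n → Fin n → Family n → Set
  StableAt i j F = ∀ A → lookup A i ≡ false → lookup A j ≡ true → F A ≡ true → F (swap i j A) ≡ true

  shift-pair-potential : {i j : Fin n} → i Fin.< j → (F : Family n) (A : Subset n) →
    indicator (shift i j F A) * value A + indicator (shift i j F (swap i j A)) * value (swap i j A)
      ≤ indicator (F A) * value A + indicator (F (swap i j A)) * value (swap i j A)
  shift-pair-potential {i = i} {j} i<j F A = subst
    (λ b → indicator (shift i j F A) * value A + indicator b * value A′ ≤ indicator (F A) * value A + indicator (F A′) * value A′)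
    (sym (shift-swap i≢j F A))
    (go (lookup A i) (lookup A j) (F A) (F A′) (λ ei ej → <⇒≤ (value-swap A i<j ei ej))
      (λ ei ej → subst (λ B → value B ≤ value A′) (swap-involutive i≢j A)
        (<⇒≤ (value-swap A′ i<j (trans (lookup-swapˡ i≢j A) ej) (trans (lookup-swapʳ i j A) ei)))))
    where
    A′ = swap i j A
    i≢j = Finₚ.<⇒≢ i<j
    go : ∀ a b f f′ {x y} → (a ≡ false → b ≡ true → y ≤ x) → (a ≡ true → b ≡ false → x ≤ y) →
      indicator (compress a b f f′) * x + indicator (compress b a f′ f) * y ≤ indicator f * x + indicator f′ * y
    go true  true  f     f′    d u = ≤-refl
    go false false f     f′    d u = ≤-refl
    go true  false true  true  d u = ≤-refl
    go true  false true  false d u = ≤-refl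
    go true  false false false d u = ≤-refl
    go true  false false true  {x} {y} d u = ≤-trans (≤-reflexive (+-identityʳ _)) (*-monoʳ-≤ 1 (u refl refl))
    go false true  true  true  d u = ≤-refl
    go false true  false true  d u = ≤-refl
    go false true  false false d u = ≤-refl
    go false true  true  false {x} {y} d u = ≤-trans (*-monoʳ-≤ 1 (d refl refl)) (m≤m+n (1 * x) 0)

  -- No pair of sets gains potential, so if the total does not fall then each pair keeps its share.
  -- A member whose swap is missing would have been replaced by that swap, which has smaller value.
  stable-if-potential-kept : {i j : Fin n} → i Fin.< j → (F : Family n) →
    potential F ≤ potential (shift i j F) → StableAt i j F
  stable-if-potential-kept {i = i} {j} i<j F le A ei ej FA = go (F (swap i j A)) refl
    where
    i≢j = Finₚ.<⇒≢ i<j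
    tight = total-tight (shift-pair-potential i<j F)
      (subst₂ _≤_ (sym (total-double i≢j (λ A → indicator (F A) * value A)))
                  (sym (total-double i≢j (λ A → indicator (shift i j F A) * value A))) (+-mono-≤ le le)) A
    moved : F (swap i j A) ≡ false → shift i j F (swap i j A) ≡ true
    moved e = trans (shift-swap i≢j F A) (trans
      (cong₂ (λ a b → compress a b (F (swap i j A)) (F A)) ej ei) (cong₂ _∨_ e FA))
    left : F (swap i j A) ≡ false → shift i j F A ≡ false
    left e = trans (cong₂ (λ a b → compress a b (F A) (F (swap i j A))) ei ej) (cong₂ _∧_ FA e)
    go : ∀ f′ → F (swap i j A) ≡ f′ → f′ ≡ true
    go true  e = refl
    go false e = ⊥-elim (<-irrefl values (value-swap A i<j ei ej))
      where
      weigh : Bool → Bool → ℕ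
      weigh b c = indicator b * value A + indicator c * value (swap i j A)
      values : value (swap i j A) ≡ value A
      values = trans (sym (+-identityʳ _)) (trans (sym (cong₂ weigh (left e) (moved e)))
        (trans tight (trans (cong₂ weigh FA e) (trans (+-identityʳ _) (+-identityʳ _)))))

  -- Presents the degree at a point other than `i` and `j` as the size of a shifted family, to which
  -- `size-shift` applies.
  shift-∧ : {i j : Fin n} (P F : Family n) → (∀ A → P (swap i j A) ≡ P A) →
    ∀ A → shift i j (λ A → P A ∧ F A) A ≡ P A ∧ shift i j F A
  shift-∧ {i = i} {j} P F inv A = trans
    (cong (λ b → compress (lookup A i) (lookup A j) (P A ∧ F A) (b ∧ F (swap i j A))) (inv A))
    (go (P A) (lookup A i) (lookup A j))
    where
    go : ∀ b c d {f f′} → compress c d (b ∧ f) (b ∧ f′) ≡ b ∧ compress c d f f′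
    go true  c     d     = refl
    go false true  true  = refl
    go false true  false = refl
    go false false true  = refl
    go false false false = refl

  -- Traces of a k-uniform family on s of its points leave members of size k − s.
  UniformUpTo : ℕ → ℕ → Family n → Set
  UniformUpTo k s F = ∀ A → F A ≡ true → ∣ A ∣ + s ≡ k

  shift-member : (i j : Fin n) (F : Family n) (A : Subset n) → shift i j F A ≡ true →
    F A ≡ true ⊎ (lookup A i ≡ true × lookup A j ≡ false × F (swap i j A) ≡ true)
  shift-member i j F A h = go (lookup A i) (lookup A j) (F A) (F (swap i j A)) h
    where
    go : ∀ a b f f′ → compress a b f f′ ≡ true → f ≡ true ⊎ (a ≡ true × b ≡ false × f′ ≡ true)
    go true  true  f    f′ h = inj₁ h
    go false false f    f′ h = inj₁ h
    go false true  true f′ h = inj₁ refl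
    go true  false true f′ h = inj₁ refl
    go true  false false f′ h = inj₂ (refl , refl , h)

  shift-kept : (i j : Fin n) (F : Family n) (A : Subset n) → lookup A i ≡ false → lookup A j ≡ true →
    shift i j F A ≡ true → F (swap i j A) ≡ true
  shift-kept i j F A ei ej h = go (F A) (trans (sym (cong₂ (λ a b → compress a b (F A) (F (swap i j A))) ei ej)) h)
    where
    go : ∀ f {f′} → f ∧ f′ ≡ true → f′ ≡ true
    go true h = h

  uniform-shift : {k s : ℕ} {i j : Fin n} → i ≢ j → {F : Family n} → UniformUpTo k s F → UniformUpTo k s (shift i j F)
  uniform-shift {s = s} {i} {j} i≢j {F} u A h with shift-member i j F A h
  ... | inj₁ FA           = u A FA
  ... | inj₂ (_ , _ , FA) = trans (cong (_+ s) (sym (∣swap∣ i≢j A))) (u _ FA)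

  Meet : Subset n → Subset n → Set
  Meet A B = ∃ λ x → lookup A x ≡ true × lookup B x ≡ true

  CrossIntersecting : Family n → Family n → Set
  CrossIntersecting F G = ∀ A B → F A ≡ true → G B ≡ true → Meet A B

  meet-sym : {A B : Subset n} → Meet A B → Meet B A
  meet-sym (x , a , b) = x , b , a

  meet-swap : {i j : Fin n} → i ≢ j → {A B : Subset n} → Meet (swap i j A) (swap i j B) → Meet A B
  meet-swap {i = i} {j} i≢j {A} {B} (x , a , b) with x ≟ᶠ i
  ... | yes refl = j , trans (sym (lookup-swapˡ i≢j A)) a , trans (sym (lookup-swapˡ i≢j B)) b
  ... | no x≢i with x ≟ᶠ j
  ...   | yes refl = i , trans (sym (lookup-swapʳ i j A)) a , trans (sym (lookup-swapʳ i j B)) b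
  ...   | no x≢j   = x , trans (sym (lookup-swap x≢i x≢j A)) a , trans (sym (lookup-swap x≢i x≢j B)) b

  meet-swapˡ : {i j : Fin n} → {A B : Subset n} → lookup B i ≡ false → lookup B j ≡ false → Meet (swap i j A) B → Meet A B
  meet-swapˡ {i = i} {j} {A} bi bj (x , a , b) with x ≟ᶠ i
  ... | yes refl = case trans (sym bi) b of λ ()
  ... | no x≢i with x ≟ᶠ j
  ...   | yes refl = case trans (sym bj) b of λ ()
  ...   | no x≢j   = x , trans (sym (lookup-swap x≢i x≢j A)) a , b

  -- The case of a new set `A` and an old set `B`. If `B` has `i`, they meet there. If it has only
  -- `j`, it was kept because its swap is a member too, and the two swaps meet. If it has neither,
  -- it meets the swap of `A` at a third point.
  meet-moved : {i j : Fin n} → i ≢ j → {F G : Family n} → CrossIntersecting F G → ∀ A B →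
    lookup A i ≡ true → F (swap i j A) ≡ true → G B ≡ true → shift i j G B ≡ true → Meet A B
  meet-moved {i = i} {j} i≢j {F} {G} c A B ai FA GB SB = go (lookup B i) (lookup B j) refl refl
    where
    go : ∀ a b → lookup B i ≡ a → lookup B j ≡ b → Meet A B
    go true  _     bi bj = i , ai , bi
    go false true  bi bj = meet-swap i≢j {A} {B} (c _ _ FA (shift-kept i j G B bi bj SB))
    go false false bi bj = meet-swapˡ {A = A} {B} bi bj (c _ _ FA GB)

  cross-shift : {i j : Fin n} → i ≢ j → {F G : Family n} → CrossIntersecting F G → CrossIntersecting (shift i j F) (shift i j G)
  cross-shift {i = i} {j} i≢j {F} {G} c A B SA SB with shift-member i j F A SA | shift-member i j G B SB
  ... | inj₁ FA            | inj₁ GB             = c A B FA GB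
  ... | inj₂ (ai , _ , FA) | inj₂ (bi , _ , GB)  = i , ai , bi
  ... | inj₂ (ai , _ , FA) | inj₁ GB             = meet-moved i≢j c A B ai FA GB SB
  ... | inj₁ FA            | inj₂ (bi , _ , GB)  =
    meet-sym {A = B} {A} (meet-moved i≢j (λ B A g f → meet-sym {A = A} {B} (c A B f g)) B A bi GB FA SA)

  Stable : Family n → Set
  Stable F = ∀ {i j} → i Fin.< j → StableAt i j F

  -- Dominance order and walks

  -- A with d further elements in front of it has at least as many elements in every initial segment
  -- as B, and equally many in total.
  data Dominates : ℕ → Subset n → Subset n → Set where
    []    : Dominates 0 [] []
    _∷_   : ∀ {d} {A B : Subset n} (b : Bool) → Dominates d A B → Dominates d (b ∷ A) (b ∷ B)
    gain  : ∀ {d} {A B : Subset n} → Dominates (suc d) A B → Dominates d (true ∷ A) (false ∷ B)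
    spend : ∀ {d} {A B : Subset n} → Dominates d A B → Dominates (suc d) (false ∷ A) (true ∷ B)

  -- The first `spend` marks an element of `B` that rests on credit; taking it out of `B` releases
  -- one unit.
  repay : {d : ℕ} {A B : Subset n} → Dominates (suc d) A B →
    ∃ λ j → lookup B j ≡ true × Dominates d A (B [ j ]≔ false)
  repay (b ∷ δ) with repay δ
  ... | j , e , δ′ = suc j , e , b ∷ δ′
  repay (gain δ) with repay δ
  ... | j , e , δ′ = suc j , e , gain δ′
  repay (spend δ) = zero , refl , false ∷ δ

  stable-∷ : {F : Family (suc n)} (b : Bool) → Stable F → Stable (F ∘ (b ∷_))
  stable-∷ b st i<j A = st (s≤s i<j) (b ∷ A)

  -- At a `gain`, stability moves to the front the element that `repay` takes out of `B`; then the
  -- tails are compared.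
  stable-upward : {F : Family n} → Stable F → {A B : Subset n} → Dominates 0 A B → F B ≡ true → F A ≡ true
  stable-upward st []      h = h
  stable-upward st (b ∷ δ) h = stable-upward (stable-∷ b st) δ h
  stable-upward {F = F} st (gain {B = B} δ) h with repay δ
  ... | j , e , δ′ = stable-upward (stable-∷ true st) δ′
    (subst (λ b → F (b ∷ B [ j ]≔ false) ≡ true) e (st (s≤s z≤n) (false ∷ B) refl e h))

  -- Prefix-wise, the common elements are at most c more than the elements missed by both sets.
  data Avoidable : ℕ → Subset n → Subset n → Set where
    []   : ∀ {c} → Avoidable c [] []
    both : ∀ {c} {A B : Subset n} → Avoidable c A B → Avoidable (suc c) (true ∷ A) (true ∷ B)
    neither : ∀ {c} {A B : Subset n} → Avoidable (suc c) A B → Avoidable c (false ∷ A) (false ∷ B)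
    one  : ∀ {c} {A B : Subset n} (b : Bool) → Avoidable c A B → Avoidable c (b ∷ A) (not b ∷ B)

  meet-tail : {b c : Bool} {A B : Subset n} → b ∧ c ≡ false → Meet (b ∷ A) (c ∷ B) → Meet A B
  meet-tail e (suc x , a , b)       = x , a , b
  meet-tail e (zero , refl , refl)  = case e of λ ()

  -- `A′` arises from `A` by moving each common element forward to a point that both sets miss; `d`
  -- counts those for which a place must still be found further in front. With `c = 0` none is left
  -- over.
  avoid : {c : ℕ} {A B : Subset n} → Avoidable c A B →
    ∃ λ d → ∃ λ A′ → d ≤ c × Dominates d A′ A × ¬ Meet A′ B
  avoid [] = 0 , [] , z≤n , [] , λ ()
  avoid (both v) with avoid v
  ... | d , A′ , le , δ , dis = suc d , false ∷ A′ , s≤s le , spend δ , dis ∘ meet-tail refl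
  avoid (neither v) with avoid v
  ... | zero  , A′ , le     , δ , dis = 0 , false ∷ A′ , z≤n , false ∷ δ , dis ∘ meet-tail refl
  ... | suc d , A′ , s≤s le , δ , dis = d , true ∷ A′ , le , gain δ , dis ∘ meet-tail refl
  avoid (one b v) with avoid v
  ... | d , A′ , le , δ , dis = d , b ∷ A′ , le , b ∷ δ , dis ∘ meet-tail (lemma b)
    where
    lemma : ∀ b → b ∧ not b ≡ false
    lemma true  = refl
    lemma false = refl

  -- The walk that starts at height c and goes down at the elements of A, up elsewhere, visits 0.
  hits : ℕ → Family n
  hits zero    A           = true
  hits (suc c) []          = false
  hits (suc c) (true ∷ A)  = hits c A
  hits (suc c) (false ∷ A) = hits (2 + c) A

  -- Raising `r` weakens this condition, and in `stable-cross` its failure then yields a stronger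
  -- condition on the other family.
  early : ℕ → Family n
  early zero    A           = hits 1 A
  early (suc r) []          = false
  early (suc r) (true ∷ A)  = true
  early (suc r) (false ∷ A) = early r A

  -- The sum of the two heights falls by 2 at a common element, rises by 2 at a point of neither set
  -- and stays put elsewhere. As neither walk visits 0, both heights are at least 2 before a common
  -- element; the sum is then at least 4, so the allowance `c` is positive there.
  hits-avoidable : (x y c : ℕ) (A B : Subset n) → x + y ≤ 3 + (c + c) → hits x A ≡ false → hits y B ≡ false → Avoidable c A B
  hits-avoidable (suc x) (suc y) c [] [] le hA hB = []
  hits-avoidable (suc x) (suc y) c (true ∷ A)  (false ∷ B) le hA hB =
    one true (hits-avoidable x (2 + y) c A B (≤-trans (≤-reflexive (lemma x y)) le) hA hB)
    where
    lemma : ∀ x y → x + (2 + y) ≡ suc x + suc y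
    lemma = solve-∀
  hits-avoidable (suc x) (suc y) c (false ∷ A) (true ∷ B)  le hA hB =
    one false (hits-avoidable (2 + x) y c A B (≤-trans (≤-reflexive (lemma x y)) le) hA hB)
    where
    lemma : ∀ x y → 2 + x + y ≡ suc x + suc y
    lemma = solve-∀
  hits-avoidable (suc x) (suc y) c (false ∷ A) (false ∷ B) le hA hB =
    neither (hits-avoidable (2 + x) (2 + y) (suc c) A B
      (≤-trans (≤-reflexive (lemma x y)) (≤-trans (+-monoʳ-≤ 2 le) (≤-reflexive (lemma′ c)))) hA hB)
    where
    lemma : ∀ x y → 2 + x + (2 + y) ≡ 2 + (suc x + suc y)
    lemma = solve-∀
    lemma′ : ∀ c → 2 + (3 + (c + c)) ≡ 3 + (suc c + suc c)
    lemma′ = solve-∀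
  hits-avoidable (suc (suc x)) (suc (suc y)) zero (true ∷ A) (true ∷ B) le hA hB =
    ⊥-elim (<⇒≱ (≤-trans (≤-reflexive (lemma x y)) le) (m≤m+n 3 (x + y)))
    where
    lemma : ∀ x y → 4 + (x + y) ≡ suc (suc x) + suc (suc y)
    lemma = solve-∀
  hits-avoidable (suc (suc x)) (suc (suc y)) (suc c) (true ∷ A) (true ∷ B) le hA hB =
    both (hits-avoidable (suc x) (suc y) c A B (+-cancelˡ-≤ 2 _ _
      (≤-trans (≤-reflexive (lemma x y)) (≤-trans le (≤-reflexive (lemma′ c))))) hA hB)
    where
    lemma : ∀ x y → 2 + (suc x + suc y) ≡ suc (suc x) + suc (suc y)
    lemma = solve-∀
    lemma′ : ∀ c → 3 + (suc c + suc c) ≡ 2 + (3 + (c + c))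
    lemma′ = solve-∀

  -- `B` has none of the first `r` points, so no allowance is used up there. After them the height
  -- of `A` is at most `2 + (c + c)` for the current `c` and that of `B` is 1, which is what
  -- `hits-avoidable` asks for.
  early-avoidable : (r x c : ℕ) (A B : Subset n) → x ≤ 2 + r + (c + c) → hits x A ≡ false → early r B ≡ false → Avoidable c A B
  early-avoidable zero    x       c A B le hA hB =
    hits-avoidable x 1 c A B (≤-trans (≤-reflexive (+-comm x 1)) (s≤s le)) hA hB
  early-avoidable (suc r) (suc x) c [] [] le hA hB = []
  early-avoidable (suc r) (suc x) c (true ∷ A)  (false ∷ B) (s≤s le) hA hB = one true (early-avoidable r x c A B le hA hB)
  early-avoidable (suc r) (suc x) c (false ∷ A) (false ∷ B) le hA hB =
    neither (early-avoidable r (2 + x) (suc c) A B (≤-trans (s≤s le) (≤-reflexive (lemma r c))) hA hB)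
    where
    lemma : ∀ r c → suc (2 + suc r + (c + c)) ≡ 2 + r + (suc c + suc c)
    lemma = solve-∀

  -- Otherwise `avoid` would yield a set disjoint from `B` that dominates `A` and so lies in the
  -- stable family `F`.
  stable-cross : {F G : Family n} (r : ℕ) → Stable F → CrossIntersecting F G → {B : Subset n} →
    G B ≡ true → early r B ≡ false → ∀ A → F A ≡ true → hits (2 + r) A ≡ true
  stable-cross r st c {B} GB eB A FA with hits (2 + r) A in hA
  ... | true  = refl
  ... | false with avoid (early-avoidable r (2 + r) 0 A B (≤-reflexive (sym (+-identityʳ _))) hA eB)
  ...   | .0 , A′ , z≤n , δ , dis = ⊥-elim (dis (c A′ B (stable-upward st δ FA) GB))

  -- choose m k j is the binomial coefficient of m over k − j, which is 0 if k < j.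
  choose : ℕ → ℕ → ℕ → ℕ
  choose zero    k j = indicator (k ≡ᵇ j)
  choose (suc m) k j = choose m k j + choose m k (suc j)

  choose-mono : ∀ m k j → choose m k j ≤ choose (suc m) k j
  choose-mono m k j = m≤m+n _ _

  uniform-true : {k s : ℕ} {F : Family (suc n)} → UniformUpTo k s F → UniformUpTo k (suc s) (F ∘ (true ∷_))
  uniform-true {s = s} u A h = trans (+-suc ∣ A ∣ s) (u (true ∷ A) h)

  uniform-false : {k s : ℕ} {F : Family (suc n)} → UniformUpTo k s F → UniformUpTo k s (F ∘ (false ∷_))
  uniform-false u A h = u (false ∷ A) h

  size-uniform : {k s : ℕ} {F : Family n} → UniformUpTo k s F → size F ≤ choose n k s
  size-uniform {zero} {k} {s} {F} u with F [] in eq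
  ... | false = z≤n
  ... | true rewrite sym (u [] eq) = indicator-mono {true} λ _ → Equivalence.to T-≡ (≡⇒≡ᵇ s s refl)
  size-uniform {suc n} {k} {s} {F} u = subst (size F ≤_) (+-comm (choose n k (suc s)) (choose n k s))
    (+-mono-≤ (size-uniform (uniform-true u)) (size-uniform (uniform-false u)))

  -- The reflection principle: the walks hitting 0 are as many as all walks with c fewer elements.
  size-hits : {k s : ℕ} (c : ℕ) {F : Family n} → UniformUpTo k s F → (∀ A → F A ≡ true → hits c A ≡ true) →
    size F ≤ choose n k (c + s)
  size-hits zero u h = size-uniform u
  size-hits {zero} (suc c) {F} u h with F [] in eq
  ... | false = z≤n
  ... | true  = case h [] eq of λ ()
  size-hits {suc n} {k} {s} (suc c) {F} u h = +-mono-≤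
    (subst (λ j → size (F ∘ (true ∷_)) ≤ choose n k j) (+-suc c s) (size-hits c (uniform-true u) (λ A → h (true ∷ A))))
    (size-hits (2 + c) (uniform-false u) (λ A → h (false ∷ A)))

  -- One summand for each of the first `r` points, counting the sets whose first element it is, and
  -- one for the walk that starts behind them.
  size-early : {k s : ℕ} (r : ℕ) {F : Family n} → UniformUpTo k s F → (∀ A → F A ≡ true → early r A ≡ true) →
    size F ≤ suc r * choose n k (suc s)
  size-early zero u h = ≤-trans (size-hits 1 u h) (≤-reflexive (sym (*-identityˡ _)))
  size-early {zero} (suc r) {F} u h with F [] in eq
  ... | false = z≤n
  ... | true  = case h [] eq of λ ()
  size-early {suc n} {k} {s} (suc r) u h = +-mono-≤
    (≤-trans (size-uniform (uniform-true u)) (choose-mono n k (suc s)))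
    (≤-trans (size-early r (uniform-false u) (λ A → h (false ∷ A))) (*-monoʳ-≤ (suc r) (choose-mono n k (suc s))))

  -- Bounds for cross-intersecting families

  record ShiftedPair (k s s′ : ℕ) (F G : Family n) : Set where
    field
      {F′ G′}   : Family n
      sizeˡ     : size F′ ≡ size F
      sizeʳ     : size G′ ≡ size G
      uniformˡ  : UniformUpTo k s F′
      uniformʳ  : UniformUpTo k s′ G′
      cross     : CrossIntersecting F′ G′
      stableˡ   : Stable F′

  -- Both families undergo the same shifts, which keeps them cross-intersecting; the potential of
  -- `F` alone decides when to stop.
  shift-pair-fully : {k s s′ : ℕ} {F G : Family n} → UniformUpTo k s F → UniformUpTo k s′ G →
    CrossIntersecting F G → ShiftedPair k s s′ F G
  shift-pair-fully {n} {k} {s} {s′} {F} {G} = go F G (<-wellFounded (potential F))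
    where
    go : ∀ F G → Acc _<_ (potential F) → UniformUpTo k s F → UniformUpTo k s′ G → CrossIntersecting F G → ShiftedPair k s s′ F G
    go F G (acc smaller) u v c
      with Finₚ.any? (λ i → Finₚ.any? (λ j → (i Finₚ.<? j) ×-dec (potential (shift i j F) <? potential F)))
    ... | no none = record
      { sizeˡ = refl ; sizeʳ = refl ; uniformˡ = u ; uniformʳ = v ; cross = c
      ; stableˡ = λ {i} {j} i<j → stable-if-potential-kept i<j F (≮⇒≥ (λ lt → none (i , j , i<j , lt))) }
    ... | yes (i , j , i<j , lt) = record
      { sizeˡ = trans (sizeˡ) (size-shift i≢j F) ; sizeʳ = trans sizeʳ (size-shift i≢j G)
      ; uniformˡ = uniformˡ ; uniformʳ = uniformʳ ; cross = cross ; stableˡ = stableˡ }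
      where
      i≢j = Finₚ.<⇒≢ i<j
      open ShiftedPair (go (shift i j F) (shift i j G) (smaller lt)
        (uniform-shift i≢j u) (uniform-shift i≢j v) (cross-shift i≢j c))

  member-outside : (P F : Family n) → (∃ λ A → F A ≡ true × P A ≡ false) ⊎ (∀ A → F A ≡ true → P A ≡ true)
  member-outside P F with search (λ A → F A ∧ not (P A))
  ... | inj₁ (A , h) = inj₁ (A , lemma (F A) (P A) h)
    where
    lemma : ∀ f p → f ∧ not p ≡ true → f ≡ true × p ≡ false
    lemma true false h = refl , refl
  ... | inj₂ h = inj₂ λ A FA → lemma (F A) (P A) (h A) FA
    where
    lemma : ∀ f p → f ∧ not p ≡ false → f ≡ true → p ≡ true
    lemma true true h e = refl

  cross-hits : {k s′ : ℕ} (r : ℕ) {F G : Family n} → Stable F → UniformUpTo k s′ G → CrossIntersecting F G →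
    suc r * choose n k (suc s′) < size G → ∀ A → F A ≡ true → hits (2 + r) A ≡ true
  cross-hits r {F} {G} st v c big with member-outside (early r) G
  ... | inj₁ (B , GB , eB) = stable-cross r st c GB eB
  ... | inj₂ all           = ⊥-elim (<⇒≱ big (size-early r v all))

  -- The opposite use of `stable-cross`: a large stable family constrains the other one. It is meant
  -- for traces that are stable already, so that the conclusion concerns `G` itself and not a
  -- shifted copy.
  cross-early : {k s : ℕ} (r : ℕ) {F G : Family n} → Stable F → UniformUpTo k s F → CrossIntersecting F G →
    choose n k (2 + r + s) < size F → ∀ B → G B ≡ true → early r B ≡ true
  cross-early r {F} {G} st u c big B GB with early r B in eB
  ... | true  = refl
  ... | false = ⊥-elim (<⇒≱ big (size-hits (2 + r) u (stable-cross r st c GB eB)))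

  -- After shifting, the large family still has a member that is not `early r`. This forces every
  -- walk of the other family down from height `2 + r`, and reflection trades the height for that
  -- many elements.
  cross-bound : {k s s′ : ℕ} (r : ℕ) {F G : Family n} → UniformUpTo k s F → UniformUpTo k s′ G →
    CrossIntersecting F G → suc r * choose n k (suc s′) < size G → size F ≤ choose n k (2 + r + s)
  cross-bound {n} {k} {s} {s′} r {F} {G} u v c big =
    subst (_≤ choose n k (2 + r + s)) sizeˡ (size-hits (2 + r) uniformˡ
      (cross-hits r stableˡ uniformʳ cross (subst (suc r * choose n k (suc s′) <_) (sym sizeʳ) big)))
    where open ShiftedPair (shift-pair-fully u v c)

  -- Traces and degrees

  trace : Vec Bool p → Family (p + n) → Family n
  trace bs F A = F (bs ++ A)

  size-trace-≤ : (bs : Vec Bool p) (F : Family (p + n)) → size (trace bs F) ≤ size F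
  size-trace-≤ []           F = ≤-refl
  size-trace-≤ (true ∷ bs)  F = ≤-trans (size-trace-≤ bs (F ∘ (true ∷_))) (m≤m+n _ _)
  size-trace-≤ (false ∷ bs) F = ≤-trans (size-trace-≤ bs (F ∘ (false ∷_))) (m≤n+m _ _)

  uniform-trace : {k s : ℕ} (bs : Vec Bool p) {F : Family (p + n)} → UniformUpTo k s F → UniformUpTo k (∣ bs ∣ + s) (trace bs F)
  uniform-trace []           u = u
  uniform-trace {k = k} {s} (true ∷ bs) {F} u =
    subst (λ j → UniformUpTo k j (trace (true ∷ bs) F)) (+-suc ∣ bs ∣ s) (uniform-trace bs (uniform-true {F = F} u))
  uniform-trace (false ∷ bs) {F} u = uniform-trace bs (uniform-false {F = F} u)

  disjoint : Vec Bool p → Vec Bool p → Bool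
  disjoint []       []       = true
  disjoint (b ∷ bs) (c ∷ cs) = not (b ∧ c) ∧ disjoint bs cs

  meet-++ : (bs cs : Vec Bool p) {A B : Subset n} → T (disjoint bs cs) → Meet (bs ++ A) (cs ++ B) → Meet A B
  meet-++ []           []           d mt = mt
  meet-++ (true ∷ bs)  (false ∷ cs) d mt = meet-++ bs cs d (meet-tail refl mt)
  meet-++ (false ∷ bs) (c ∷ cs)     d mt = meet-++ bs cs d (meet-tail refl mt)

  cross-trace : (bs cs : Vec Bool p) {F : Family (p + n)} → T (disjoint bs cs) → CrossIntersecting F F →
    CrossIntersecting (trace bs F) (trace cs F)
  cross-trace bs cs d c A B FA FB = meet-++ bs cs d (c _ _ FA FB)

  swap-++ : (bs : Vec Bool p) (i j : Fin n) (A : Subset n) → swap (p ↑ʳ i) (p ↑ʳ j) (bs ++ A) ≡ bs ++ swap i j A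
  swap-++ []       i j A = refl
  swap-++ (b ∷ bs) i j A = cong (b ∷_) (swap-++ bs i j A)

  stable-arrange : (s : Selection p n) {F : Family n} {i j : Fin n} → i ≢ j →
    StableAt (position s i) (position s j) F → StableAt i j (F ∘ arrange s)
  stable-arrange s {F} {i} {j} i≢j st A ei ej h = subst (λ B → F B ≡ true) (sym (arrange-swap s i≢j A))
    (st (arrange s A) (trans (lookup-arrange s A i) ei) (trans (lookup-arrange s A j) ej) h)

  stable-trace : {F : Family (p + n)} → (∀ {i j : Fin n} → i Fin.< j → StableAt (p ↑ʳ i) (p ↑ʳ j) F) →
    (bs : Vec Bool p) → Stable (trace bs F)
  stable-trace {F = F} st bs {i} {j} i<j A ei ej h = subst (λ B → F B ≡ true) (swap-++ bs i j A)
    (st i<j (bs ++ A) (trans (lookup-++ʳ bs A i) ei) (trans (lookup-++ʳ bs A j) ej) h)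

  StableOutside : List (Fin n) → Family n → Set
  StableOutside X F = ∀ i j → i Fin.< j → All (i ≢_) X → All (j ≢_) X → StableAt i j F

  degreeOf : Fin n → Family n → ℕ
  degreeOf x F = size (λ A → lookup A x ∧ F A)

  link : Fin n → Fin n → Family n → Family n
  link x y F A = lookup A x ∧ (lookup A y ∧ F A)

  link∖ : Fin n → Fin n → Fin n → Family n → Family n
  link∖ x y z F A = lookup A x ∧ (lookup A y ∧ (not (lookup A z) ∧ F A))

  codegree : Fin n → Fin n → Family n → ℕ
  codegree x y F = size (link x y F)

  codegree∖ : Fin n → Fin n → Fin n → Family n → ℕ
  codegree∖ x y z F = size (link∖ x y z F)

  avoiding : Fin n → Fin n → Family n → ℕ
  avoiding x y F = size (λ A → not (lookup A x) ∧ (not (lookup A y) ∧ F A))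

  codegree-sym : (x y : Fin n) (F : Family n) → codegree x y F ≡ codegree y x F
  codegree-sym x y F = size-cong (λ A → trans (sym (∧-assoc (lookup A x) _ _))
    (trans (cong (_∧ F A) (∧-comm (lookup A x) (lookup A y))) (∧-assoc (lookup A y) _ _)))

  module _ (s : Selection p n) (F : Family n) where

    size-arrange : size (F ∘ arrange s) ≡ size F
    size-arrange = total-arrange s (indicator ∘ F)

    degree-arrange : ∀ x → degreeOf x (F ∘ arrange s) ≡ degreeOf (position s x) F
    degree-arrange x = trans (size-cong (λ A → cong (_∧ F (arrange s A)) (sym (lookup-arrange s A x))))
      (total-arrange s (λ A → indicator (lookup A (position s x) ∧ F A)))

    codegree-arrange : ∀ x y → codegree x y (F ∘ arrange s) ≡ codegree (position s x) (position s y) F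
    codegree-arrange x y = trans
      (size-cong (λ A → cong₂ (λ b c → b ∧ (c ∧ F (arrange s A))) (sym (lookup-arrange s A x)) (sym (lookup-arrange s A y))))
      (total-arrange s (λ A → indicator (lookup A (position s x) ∧ (lookup A (position s y) ∧ F A))))

    codegree∖-arrange : ∀ x y z →
      codegree∖ x y z (F ∘ arrange s) ≡ codegree∖ (position s x) (position s y) (position s z) F
    codegree∖-arrange x y z = trans
      (size-cong (λ A → trans
        (cong₂ (λ b c → b ∧ (c ∧ (not (lookup A z) ∧ F (arrange s A)))) (sym (lookup-arrange s A x)) (sym (lookup-arrange s A y)))
        (cong (λ d → lookup (arrange s A) (position s x) ∧ (lookup (arrange s A) (position s y) ∧ (not d ∧ F (arrange s A))))
          (sym (lookup-arrange s A z)))))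
      (total-arrange s (λ A → indicator (lookup A (position s x) ∧ (lookup A (position s y) ∧ (not (lookup A (position s z)) ∧ F A)))))

    avoiding-arrange : ∀ x y → avoiding x y (F ∘ arrange s) ≡ avoiding (position s x) (position s y) F
    avoiding-arrange x y = trans
      (size-cong (λ A → cong₂ (λ b c → not b ∧ (not c ∧ F (arrange s A))) (sym (lookup-arrange s A x)) (sym (lookup-arrange s A y))))
      (total-arrange s (λ A → indicator (not (lookup A (position s x)) ∧ (not (lookup A (position s y)) ∧ F A))))

  degree-shift-≤ : {i j x : Fin n} → i ≢ j → x ≢ i → (F : Family n) → degreeOf x (shift i j F) ≤ degreeOf x F
  degree-shift-≤ {i = i} {j} {x} i≢j x≢i F with x ≟ᶠ j
  ... | no x≢j = ≤-reflexive (trans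
      (sym (size-cong (shift-∧ {i = i} {j} (λ A → lookup A x) F (lookup-swap x≢i x≢j))))
      (size-shift i≢j (λ A → lookup A x ∧ F A)))
  ... | yes refl = size-mono λ A → go (lookup A i) (lookup A x)
    where
    go : ∀ a b {f f′} → b ∧ compress a b f f′ ≡ true → b ∧ f ≡ true
    go true  true         h = h
    go false true {true}  h = refl

  -- The shift leaves sets without `i` and `j` alone, so they are among the members of the shifted
  -- family that miss `i`.
  degree+avoiding : (i j : Fin n) (F : Family n) → degreeOf i (shift i j F) + avoiding i j F ≤ size (shift i j F)
  degree+avoiding i j F = ≤-trans
    (+-monoʳ-≤ (degreeOf i (shift i j F)) (size-mono λ A → go (lookup A i) (lookup A j)))
    (≤-reflexive (sym (size-split (λ A → lookup A i) (shift i j F))))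
    where
    go : ∀ a b {f f′} → not a ∧ (not b ∧ f) ≡ true → not a ∧ compress a b f f′ ≡ true
    go false false h = h

  hits-weaken : (c : ℕ) (A : Subset n) → hits (suc c) A ≡ true → hits c A ≡ true
  hits-weaken zero    A           h = refl
  hits-weaken (suc c) (true ∷ A)  h = hits-weaken c A h
  hits-weaken (suc c) (false ∷ A) h = hits-weaken (2 + c) A h

  -- Linear forms in the sizes of traces

  pow : ℕ → ℕ
  pow zero    = 1
  pow (suc d) = pow d + pow d

  index : Vec Bool p → Fin (pow p)
  index []                     = zero
  index {suc p} (true  ∷ bs)   = index bs ↑ˡ pow p
  index {suc p} (false ∷ bs)   = pow p ↑ʳ index bs

  -- `pow` doubles by addition so that the length of this concatenation fits by computation, and
  -- `index` finds the entry of a trace by the same recursion.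
  traces : ∀ p → Family (p + n) → Vec ℕ (pow p)
  traces zero    F = size F ∷ []
  traces (suc p) F = traces p (F ∘ (true ∷_)) ++ traces p (F ∘ (false ∷_))

  W : Vec Bool p → Lin (pow p + v)
  W bs = var (index bs ↑ˡ _)

  other : ∀ p → Fin v → Lin (pow p + v)
  other p x = var (pow p ↑ʳ x)

  sumᴸ : ∀ p → (Vec Bool p → Lin v) → Lin v
  sumᴸ zero    f = f []
  sumᴸ (suc p) f = sumᴸ p (f ∘ (true ∷_)) ⊕ sumᴸ p (f ∘ (false ∷_))

  -- Evaluates to the size of the subfamily of the sets whose trace satisfies P; the variable z stands
  -- for the sum over the subsets of the remaining points of the constant 0.
  part : ∀ p → Lin (pow p + v) → (Vec Bool p → Bool) → Lin (pow p + v)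
  part p z P = sumᴸ p (λ bs → if P bs then W bs else z)

  pattern I = true
  pattern O = false

  -- Candidates for a counterexample and their shifts

  module Candidates (n k N q : ℕ) where

    record Candidate (F : Family n) : Set where
      field
        uniform      : UniformUpTo k 0 F
        intersecting : CrossIntersecting F F
        size≡        : size F ≡ N
        spread       : ∀ x → 3 * degreeOf x F + 8 * q < 2 * N

    open Candidate

    arrange-candidate : (s : Selection p n) {F : Family n} → Candidate F → Candidate (F ∘ arrange s)
    arrange-candidate s {F} C .uniform A h = trans (cong (_+ 0) (sym (∣arrange∣ s A))) (C .uniform _ h)
    arrange-candidate s {F} C .intersecting A B hA hB with C .intersecting _ _ hA hB
    ... | x , a , b with position-surjective s x
    ...   | y , refl = y , trans (sym (lookup-arrange s A y)) a , trans (sym (lookup-arrange s B y)) b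
    arrange-candidate s {F} C .size≡ = trans (size-arrange s F) (C .size≡)
    arrange-candidate s {F} C .spread x = subst (λ d → 3 * d + 8 * q < 2 * N) (sym (degree-arrange s F x)) (C .spread (position s x))

    Bad : Fin n → Fin n → Family n → Set
    Bad x y F = 3 * avoiding x y F ≤ N + 8 * q

    bad-sym : (x y : Fin n) (F : Family n) → Bad x y F → Bad y x F
    bad-sym x y F = subst (λ a → 3 * a ≤ N + 8 * q) (size-cong (λ A → trans (sym (∧-assoc (not (lookup A x)) _ _))
      (trans (cong (_∧ F A) (∧-comm (not (lookup A x)) _)) (∧-assoc (not (lookup A y)) _ _))))

    record Extremal (F : Family n) : Set where
      field
        candidate     : Candidate F
        stable-or-bad : ∀ {i j} → i Fin.< j → StableAt i j F ⊎ Bad i j F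

    open Extremal

    shift-candidate : {F : Family n} {i j : Fin n} → i ≢ j → Candidate F →
      (∀ x → 3 * degreeOf x (shift i j F) + 8 * q < 2 * N) → Candidate (shift i j F)
    shift-candidate {F} i≢j C sp = record
      { uniform = uniform-shift i≢j (C .uniform) ; intersecting = cross-shift i≢j (C .intersecting)
      ; size≡ = trans (size-shift i≢j F) (C .size≡) ; spread = sp }

    -- Shifting j to i raises no degree but that of i.
    shift-bad : {F : Family n} {i j : Fin n} → i ≢ j → Candidate F →
      (x : Fin n) → 2 * N ≤ 3 * degreeOf x (shift i j F) + 8 * q → Bad i j F
    shift-bad {F} {i} {j} i≢j C x big with x ≟ᶠ i
    ... | no x≢i = ⊥-elim (<⇒≱ (C .spread x) (≤-trans big (+-monoˡ-≤ (8 * q) (*-monoʳ-≤ 3 (degree-shift-≤ i≢j x≢i F)))))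
    ... | yes refl = ≮⇒≥ λ lt → farkas (N ∷ q ∷ degreeOf i (shift i j F) ∷ avoiding i j F ∷ [])
        ( (1 · con 1 ⊕ (var 0F ⊕ 8 ⊗ var 1F) ⩽ 3 ⊗ var 3F)
        ∷ (1 · 2 ⊗ var 0F ⩽ 3 ⊗ var 2F ⊕ 8 ⊗ var 1F)
        ∷ (3 · var 2F ⊕ var 3F ⩽ var 0F) ∷ [])
        (tt , tt)
        (lt ∷ big ∷ ≤-trans (degree+avoiding i j F) (≤-reflexive (trans (size-shift i≢j F) (C .size≡))) ∷ [])

    -- Only shifts that lower the potential and preserve `spread` are carried out. When none
    -- remains, a shift that keeps the potential shows stability, and one that destroys `spread`
    -- shows a bad pair.
    extremal : {F : Family n} → Candidate F → ∃ Extremal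
    extremal {F} = go F (<-wellFounded (potential F))
      where
      spread? : ∀ F → Dec (∀ x → 3 * degreeOf x F + 8 * q < 2 * N)
      spread? F = Finₚ.all? (λ x → 3 * degreeOf x F + 8 * q <? 2 * N)
      go : ∀ F → Acc _<_ (potential F) → Candidate F → ∃ Extremal
      go F (acc smaller) C with Finₚ.any? (λ i → Finₚ.any? (λ j →
        (i Finₚ.<? j) ×-dec ((potential (shift i j F) <? potential F) ×-dec spread? (shift i j F))))
      ... | yes (i , j , i<j , lt , sp) = go (shift i j F) (smaller lt) (shift-candidate (Finₚ.<⇒≢ i<j) C sp)
      ... | no none = F , record { candidate = C ; stable-or-bad = dichotomy }
        where
        dichotomy : ∀ {i j} → i Fin.< j → StableAt i j F ⊎ Bad i j F
        dichotomy {i} {j} i<j with potential (shift i j F) <? potential F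
        ... | no ≮   = inj₁ (stable-if-potential-kept i<j F (≮⇒≥ ≮))
        ... | yes lt with Finₚ.any? (λ x → 2 * N ≤? 3 * degreeOf x (shift i j F) + 8 * q)
        ...   | yes (x , big) = inj₂ (shift-bad (Finₚ.<⇒≢ i<j) C x big)
        ...   | no small      = ⊥-elim (none (i , j , i<j , lt , λ x → ≰⇒> (λ big → small (x , big))))

    BadPairOutside : List (Fin n) → Family n → Set
    BadPairOutside X F = ∃ λ i → ∃ λ j → i ≢ j × All (i ≢_) X × All (j ≢_) X × Bad i j F

    another-bad : {F : Family n} → Extremal F → (X : List (Fin n)) → BadPairOutside X F ⊎ StableOutside X F
    another-bad {F} E X with Finₚ.any? (λ i → Finₚ.any? (λ j → (i Finₚ.<? j) ×-dec
      (All.all? (λ x → ¬? (i ≟ᶠ x)) X ×-dec (All.all? (λ x → ¬? (j ≟ᶠ x)) X ×-dec (3 * avoiding i j F ≤? N + 8 * q)))))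
    ... | yes (i , j , i<j , oi , oj , b) = inj₁ (i , j , Finₚ.<⇒≢ i<j , oi , oj , b)
    ... | no none = inj₂ λ i j i<j oi oj →
      [ (λ st → st) , (λ b → ⊥-elim (none (i , j , i<j , oi , oj , b))) ]′ (E .stable-or-bad i<j)

  -- Heavy and bad pairs

  module Configuration (m k N : ℕ)
    (23q≤t : 23 * choose (2 + m) k 4 ≤ choose (2 + m) k 3)
    (36t≤N : 36 * choose (2 + m) k 3 ≤ N) where

    t q : ℕ
    t = choose (2 + m) k 3
    q = choose (2 + m) k 4

    -- The ground set is written with `5 + m` points because `no-stable-heavy` names five of them.
    V : Set
    V = Fin (5 + m)

    open Candidates (5 + m) k N q
    open Candidate
    open Extremal

    N≥1 : {F : Family (5 + m)} → Candidate F → 1 ≤ N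
    N≥1 C = *-cancelˡ-< 2 0 N (≤-trans (s≤s z≤n) (C .spread 0F))

    -- On three points, with two elements in `cs`, the values 0, 1, 2 of `r` give the thresholds
    -- `t`, `2 t`, `3 t`. The bound is `t` or `q` according as `r` and the number of elements of
    -- `bs` add up to 1 or 2.
    trace-bound : (bs cs : Vec Bool p) {F : Family (p + n)} → UniformUpTo k 0 F → CrossIntersecting F F →
      T (disjoint bs cs) → (r : ℕ) → suc r * choose n k (suc (∣ cs ∣ + 0)) < size (trace cs F) →
      size (trace bs F) ≤ choose n k (2 + r + (∣ bs ∣ + 0))
    trace-bound bs cs u c d r = cross-bound r (uniform-trace bs u) (uniform-trace cs u) (cross-trace bs cs d c)

    bound : {F : Family (p + n)} → UniformUpTo k 0 F → (bs : Vec Bool p) → size (trace bs F) ≤ choose n k (∣ bs ∣ + 0)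
    bound u bs = size-uniform (uniform-trace bs u)

    zero-sum : ∀ n → total {n} (λ _ → 0) ≤ 0
    zero-sum n = ≤-reflexive (total-0 {n})

    -- Traces on three points

    module Three {F : Family (5 + m)} (C : Candidate F) where

      ρ : Vec ℕ (pow 3 + 4)
      ρ = traces 3 F ++ (t ∷ q ∷ N ∷ total {2 + m} (λ _ → 0) ∷ [])

      tᴸ qᴸ Nᴸ zᴸ : Lin (pow 3 + 4)
      tᴸ = other 3 0F
      qᴸ = other 3 1F
      Nᴸ = other 3 2F
      zᴸ = other 3 3F

      at : Fin 3 → Vec Bool 3 → Bool
      at x bs = lookup bs x

      degᴸ : Fin 3 → Lin (pow 3 + 4)
      degᴸ x = part 3 zᴸ (at x)

      sizeᴸ : Lin (pow 3 + 4)
      sizeᴸ = sumᴸ 3 W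

      w : Bool → Bool → Bool → ℕ
      w a b c = size (trace (a ∷ b ∷ c ∷ []) F)

      cross : (bs cs : Vec Bool 3) → T (disjoint bs cs) → (r : ℕ) →
        suc r * choose (2 + m) k (suc (∣ cs ∣ + 0)) < size (trace cs F) →
        size (trace bs F) ≤ choose (2 + m) k (2 + r + (∣ bs ∣ + 0))
      cross bs cs = trace-bound bs cs (C .uniform) (C .intersecting)

      -- If the pair 12 is heavy as well, the triangle 012 has two elements of all but 4 q members;
      -- otherwise all but 4 t + 2 q members contain 0.
      cherry : 2 * t < w I I O → 2 * t < w I O I → ⊥
      cherry big₁₁₀ big₁₀₁ with w O I I ≤? 3 * t
      ... | yes w₀₁₁≤ = farkas ρ
          ( (1 · con 1 ⊕ (3 ⊗ degᴸ 0F ⊕ 8 ⊗ qᴸ) ⩽ 2 ⊗ Nᴸ)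
          ∷ (3 · Nᴸ ⩽ sizeᴸ)
          ∷ (1 · 36 ⊗ tᴸ ⩽ Nᴸ)
          ∷ (3 · W (O ∷ I ∷ I ∷ []) ⩽ 3 ⊗ tᴸ)
          ∷ (3 · W (O ∷ I ∷ O ∷ []) ⩽ qᴸ)
          ∷ (3 · W (O ∷ O ∷ I ∷ []) ⩽ qᴸ)
          ∷ (3 · W (O ∷ O ∷ O ∷ []) ⩽ tᴸ) ∷ [])
          (tt , tt)
          ( C .spread 0F ∷ ≤-reflexive (sym (C .size≡)) ∷ 36t≤N ∷ w₀₁₁≤
          ∷ cross (O ∷ I ∷ O ∷ []) (I ∷ O ∷ I ∷ []) tt 1 big₁₀₁
          ∷ cross (O ∷ O ∷ I ∷ []) (I ∷ I ∷ O ∷ []) tt 1 big₁₁₀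
          ∷ cross (O ∷ O ∷ O ∷ []) (I ∷ I ∷ O ∷ []) tt 1 big₁₁₀ ∷ [])
      ... | no w₀₁₁≰ = farkas ρ
          ( (1 · con 1 ⊕ (3 ⊗ degᴸ 0F ⊕ 8 ⊗ qᴸ) ⩽ 2 ⊗ Nᴸ)
          ∷ (1 · con 1 ⊕ (3 ⊗ degᴸ 1F ⊕ 8 ⊗ qᴸ) ⩽ 2 ⊗ Nᴸ)
          ∷ (1 · con 1 ⊕ (3 ⊗ degᴸ 2F ⊕ 8 ⊗ qᴸ) ⩽ 2 ⊗ Nᴸ)
          ∷ (6 · Nᴸ ⩽ sizeᴸ)
          ∷ (3 · W (I ∷ O ∷ O ∷ []) ⩽ qᴸ)
          ∷ (3 · W (O ∷ I ∷ O ∷ []) ⩽ qᴸ)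
          ∷ (3 · W (O ∷ O ∷ I ∷ []) ⩽ qᴸ)
          ∷ (6 · W (O ∷ O ∷ O ∷ []) ⩽ qᴸ) ∷ [])
          (tt , tt)
          ( C .spread 0F ∷ C .spread 1F ∷ C .spread 2F
          ∷ ≤-reflexive (sym (C .size≡))
          ∷ cross (I ∷ O ∷ O ∷ []) (O ∷ I ∷ I ∷ []) tt 1 (≤-<-trans (*-monoˡ-≤ t (n≤1+n 2)) big₀₁₁)
          ∷ cross (O ∷ I ∷ O ∷ []) (I ∷ O ∷ I ∷ []) tt 1 big₁₀₁
          ∷ cross (O ∷ O ∷ I ∷ []) (I ∷ I ∷ O ∷ []) tt 1 big₁₁₀
          ∷ cross (O ∷ O ∷ O ∷ []) (O ∷ I ∷ I ∷ []) tt 2 big₀₁₁ ∷ [])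
        where big₀₁₁ = ≰⇒> w₀₁₁≰

      cherry∖ : 2 * t < codegree∖ 0F 1F 2F F →
        2 * t < codegree∖ 0F 2F 1F F → ⊥
      cherry∖ big₁₁₀ big₁₀₁ = cherry
        (≰⇒> λ le → farkas ρ
          ( (1 · con 1 ⊕ 2 ⊗ tᴸ ⩽ part 3 zᴸ (λ bs → at 0F bs ∧ (at 1F bs ∧ not (at 2F bs))))
          -- Seven of the eight traces fail the condition, and each contributes one `zᴸ` to `part`.
          ∷ (1 · W (I ∷ I ∷ O ∷ []) ⩽ 2 ⊗ tᴸ) ∷ (7 · zᴸ ⩽ con 0) ∷ [])
          (tt , tt) (big₁₁₀ ∷ le ∷ zero-sum (2 + m) ∷ []))
        (≰⇒> λ le → farkas ρ
          ( (1 · con 1 ⊕ 2 ⊗ tᴸ ⩽ part 3 zᴸ (λ bs → at 0F bs ∧ (at 2F bs ∧ not (at 1F bs))))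
          ∷ (1 · W (I ∷ O ∷ I ∷ []) ⩽ 2 ⊗ tᴸ) ∷ (7 · zᴸ ⩽ con 0) ∷ [])
          (tt , tt) (big₁₀₁ ∷ le ∷ zero-sum (2 + m) ∷ []))

      codegree-≤∖ : codegree 0F 1F F ≤ codegree∖ 0F 1F 2F F + t
      codegree-≤∖ = ≮⇒≥ λ lt → farkas ρ
        ( (1 · con 1 ⊕ (part 3 zᴸ (λ bs → at 0F bs ∧ (at 1F bs ∧ not (at 2F bs))) ⊕ tᴸ)
             ⩽ part 3 zᴸ (λ bs → at 0F bs ∧ at 1F bs))
        ∷ (1 · W (I ∷ I ∷ I ∷ []) ⩽ tᴸ) ∷ [])
        (tt , tt) (lt ∷ bound (C .uniform) (I ∷ I ∷ I ∷ []) ∷ [])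

    -- The factor 4 leaves room to discard the members with one or two further points and still
    -- exceed the thresholds `2 t` for cherries and `2 c₃` in `heavy-trace`.
    Heavy : V → V → Family (5 + m) → Set
    Heavy x y F = 4 * t < codegree x y F

    heavy-sym : (x y : V) (F : Family (5 + m)) → Heavy x y F → Heavy y x F
    heavy-sym x y F = subst (4 * t <_) (codegree-sym x y F)

    no-cherry∖ : {F : Family (5 + m)} → Candidate F → {x y z : V} → x ≢ y → x ≢ z → y ≢ z →
      2 * t < codegree∖ x y z F → 2 * t < codegree∖ x z y F → ⊥
    no-cherry∖ {F} C x≢y x≢z y≢z big big′ with select₃ x≢y x≢z y≢z
    ... | s , refl , refl , refl = Three.cherry∖ (arrange-candidate s C)
      (subst (2 * t <_) (sym (codegree∖-arrange s F 0F 1F 2F)) big)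
      (subst (2 * t <_) (sym (codegree∖-arrange s F 0F 2F 1F)) big′)

    codegree-≤ : {F : Family (5 + m)} → Candidate F → {x y z : V} → x ≢ y → x ≢ z → y ≢ z →
      codegree x y F ≤ codegree∖ x y z F + t
    codegree-≤ {F} C x≢y x≢z y≢z with select₃ x≢y x≢z y≢z
    ... | s , refl , refl , refl = subst₂ (λ a b → a ≤ b + t) (codegree-arrange s F 0F 1F)
      (codegree∖-arrange s F 0F 1F 2F) (Three.codegree-≤∖ (arrange-candidate s C))

    heavy∖ : {F : Family (5 + m)} → Candidate F → {x y z : V} → x ≢ y → x ≢ z → y ≢ z →
      Heavy x y F → 2 * t < codegree∖ x y z F
    heavy∖ C x≢y x≢z y≢z h = ≰⇒> λ le → <⇒≱ h (≤-trans (codegree-≤ C x≢y x≢z y≢z)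
      (≤-trans (+-monoˡ-≤ t le) (≤-trans (≤-reflexive (+-comm (2 * t) t)) (*-monoˡ-≤ t (n≤1+n 3)))))

    no-cherry : {F : Family (5 + m)} → Candidate F → {x y z : V} → x ≢ y → x ≢ z → y ≢ z →
      Heavy x y F → Heavy x z F → ⊥
    no-cherry C x≢y x≢z y≢z h h′ =
      no-cherry∖ C x≢y x≢z y≢z (heavy∖ C x≢y x≢z y≢z h) (heavy∖ C x≢z x≢y (≢-sym y≢z) h′)

    -- Traces on four points

    module Four {F : Family (5 + m)} (C : Candidate F) where

      -- With a fourth point singled out, Pascal's rule, which is the recursion of `choose`, makes
      -- `t` compute to `c₃ + c₄` and `q` to `c₄ + c₅`.
      c₃ c₄ c₅ : ℕ
      c₃ = choose (1 + m) k 3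
      c₄ = choose (1 + m) k 4
      c₅ = choose (1 + m) k 5

      ρ : Vec ℕ (pow 4 + 5)
      ρ = traces 4 F ++ (c₃ ∷ c₄ ∷ c₅ ∷ N ∷ total {1 + m} (λ _ → 0) ∷ [])

      c₃ᴸ c₄ᴸ c₅ᴸ tᴸ qᴸ Nᴸ zᴸ sizeᴸ : Lin (pow 4 + 5)
      c₃ᴸ = other 4 0F
      c₄ᴸ = other 4 1F
      c₅ᴸ = other 4 2F
      Nᴸ = other 4 3F
      zᴸ = other 4 4F
      tᴸ = c₃ᴸ ⊕ c₄ᴸ
      qᴸ = c₄ᴸ ⊕ c₅ᴸ
      sizeᴸ = sumᴸ 4 W

      at : Fin 4 → Vec Bool 4 → Bool
      at x bs = lookup bs x

      degᴸ : Fin 4 → Lin (pow 4 + 5)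
      degᴸ x = part 4 zᴸ (at x)

      codegᴸ : Fin 4 → Fin 4 → Lin (pow 4 + 5)
      codegᴸ x y = part 4 zᴸ (λ bs → at x bs ∧ at y bs)

      codeg∖ᴸ : Fin 4 → Fin 4 → Fin 4 → Lin (pow 4 + 5)
      codeg∖ᴸ x y z = part 4 zᴸ (λ bs → at x bs ∧ (at y bs ∧ not (at z bs)))

      avoidᴸ : Fin 4 → Fin 4 → Lin (pow 4 + 5)
      avoidᴸ x y = part 4 zᴸ (λ bs → not (at x bs) ∧ not (at y bs))

      w : Bool → Bool → Bool → Bool → ℕ
      w a b c d = size (trace (a ∷ b ∷ c ∷ d ∷ []) F)

      cross : (bs cs : Vec Bool 4) → T (disjoint bs cs) → (r : ℕ) →
        suc r * choose (1 + m) k (suc (∣ cs ∣ + 0)) < size (trace cs F) →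
        size (trace bs F) ≤ choose (1 + m) k (2 + r + (∣ bs ∣ + 0))
      cross bs cs = trace-bound bs cs (C .uniform) (C .intersecting)

      traceBound : (bs : Vec Bool 4) → size (trace bs F) ≤ choose (1 + m) k (∣ bs ∣ + 0)
      traceBound = bound (C .uniform)

      heavy-trace : Heavy 0F 1F F → 2 * c₃ < w I I O O
      heavy-trace h = ≰⇒> λ le → farkas ρ
        ( (1 · con 1 ⊕ 4 ⊗ tᴸ ⩽ codegᴸ 0F 1F)
        ∷ (1 · W (I ∷ I ∷ I ∷ I ∷ []) ⩽ c₄ᴸ)
        ∷ (1 · W (I ∷ I ∷ I ∷ O ∷ []) ⩽ c₃ᴸ)
        ∷ (1 · W (I ∷ I ∷ O ∷ I ∷ []) ⩽ c₃ᴸ)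
        ∷ (1 · W (I ∷ I ∷ O ∷ O ∷ []) ⩽ 2 ⊗ c₃ᴸ)
        ∷ (12 · zᴸ ⩽ con 0) ∷ [])
        (tt , tt)
        ( h ∷ traceBound (I ∷ I ∷ I ∷ I ∷ []) ∷ traceBound (I ∷ I ∷ I ∷ O ∷ [])
        ∷ traceBound (I ∷ I ∷ O ∷ I ∷ []) ∷ le ∷ zero-sum (1 + m) ∷ [])

      -- The first heavy pair leaves more than `c₃` members with trace {0,1}, so at most `c₄` have
      -- the disjoint trace {2,3}. The codegree of 2 and 3 is then at most `2 c₃ + 2 c₄ = 2 t`.
      no-disjoint-heavy : Heavy 0F 1F F → Heavy 2F 3F F → ⊥
      no-disjoint-heavy h h′ = farkas ρ
        ( (1 · con 1 ⊕ 4 ⊗ tᴸ ⩽ codegᴸ 2F 3F)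
        ∷ (1 · W (I ∷ I ∷ I ∷ I ∷ []) ⩽ c₄ᴸ)
        ∷ (1 · W (I ∷ O ∷ I ∷ I ∷ []) ⩽ c₃ᴸ)
        ∷ (1 · W (O ∷ I ∷ I ∷ I ∷ []) ⩽ c₃ᴸ)
        ∷ (1 · W (O ∷ O ∷ I ∷ I ∷ []) ⩽ c₄ᴸ)
        ∷ (12 · zᴸ ⩽ con 0) ∷ [])
        (tt , tt)
        ( h′ ∷ traceBound (I ∷ I ∷ I ∷ I ∷ []) ∷ traceBound (I ∷ O ∷ I ∷ I ∷ [])
        ∷ traceBound (O ∷ I ∷ I ∷ I ∷ [])
        ∷ cross (O ∷ O ∷ I ∷ I ∷ []) (I ∷ I ∷ O ∷ O ∷ []) tt 0 (≤-<-trans (*-monoˡ-≤ c₃ (n≤1+n 1)) (heavy-trace h))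
        ∷ zero-sum (1 + m) ∷ [])


      -- Meant for the sizes of two complementary two-point traces: if one exceeds `c₃`, the other
      -- is at most `c₄`. The second component records that the better bound can fail only if one of
      -- them exceeds `2 t`.
      opposite : ∀ {x y} → x ≤ 4 * t → y ≤ 4 * t → (c₃ < x → y ≤ c₄) → (c₃ < y → x ≤ c₄) →
        x + y ≤ 4 * t + c₄ × (x + y ≤ 2 * t + c₄ ⊎ 2 * t < x ⊎ 2 * t < y)
      opposite {x} {y} x≤4t y≤4t f g with x ≤? c₃ | y ≤? c₃
      ... | no x≰ | _ = +-mono-≤ x≤4t (f (≰⇒> x≰)) , [ (λ x≤ → inj₁ (+-mono-≤ x≤ (f (≰⇒> x≰)))) , inj₂ ∘ inj₁ ]′ (≤-<-connex x (2 * t))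
      ... | yes _ | no y≰ = swapped y≤4t , [ inj₁ ∘ swapped , inj₂ ∘ inj₂ ]′ (≤-<-connex y (2 * t))
        where
        swapped : ∀ {b} → y ≤ b → x + y ≤ b + c₄
        swapped y≤ = ≤-trans (≤-reflexive (+-comm x y)) (+-mono-≤ y≤ (g (≰⇒> y≰)))
      ... | yes x≤ | yes y≤ = ≤-trans small (+-monoˡ-≤ c₄ (*-monoˡ-≤ t {2} {4} (s≤s (s≤s z≤n)))) , inj₁ small
        where
        small : x + y ≤ 2 * t + c₄
        small = ≤-trans (+-mono-≤ (≤-trans x≤ (m≤m+n c₃ c₄)) (≤-trans y≤ (m≤m+n c₃ c₄)))
          (≤-trans (≤-reflexive (cong (t +_) (sym (+-identityʳ t)))) (m≤m+n (2 * t) c₄))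

      -- At least `(N − 16 q) / 3` members meet both bad pairs, which is nearly `12 t`. Their traces
      -- have four, three or two elements, and these account for at most `c₄ + 4 c₃ + 6 t + 2 c₄`,
      -- hence for at most `10 t`. That `N` is positive settles `t = 0`.
      linked-count : Bad 0F 1F F → Bad 2F 3F F →
        (w I O I O + w O I O I) + (w I O O I + w O I I O) ≤ (4 * t + c₄) + (2 * t + c₄) → ⊥
      linked-count bad bad′ few = farkas ρ
        ( (36 · Nᴸ ⩽ sizeᴸ)
        ∷ (11 · 36 ⊗ tᴸ ⩽ Nᴸ)
        ∷ (1 · con 1 ⩽ Nᴸ)
        ∷ (9 · 23 ⊗ qᴸ ⩽ tᴸ)
        ∷ (12 · 3 ⊗ avoidᴸ 0F 1F ⩽ Nᴸ ⊕ 8 ⊗ qᴸ)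
        ∷ (12 · 3 ⊗ avoidᴸ 2F 3F ⩽ Nᴸ ⊕ 8 ⊗ qᴸ)
        ∷ (36 · W (I ∷ I ∷ I ∷ I ∷ []) ⩽ c₄ᴸ)
        ∷ (36 · W (I ∷ I ∷ I ∷ O ∷ []) ⩽ c₃ᴸ)
        ∷ (36 · W (I ∷ I ∷ O ∷ I ∷ []) ⩽ c₃ᴸ)
        ∷ (36 · W (I ∷ O ∷ I ∷ I ∷ []) ⩽ c₃ᴸ)
        ∷ (36 · W (O ∷ I ∷ I ∷ I ∷ []) ⩽ c₃ᴸ)
        ∷ (36 · (W (I ∷ O ∷ I ∷ O ∷ []) ⊕ W (O ∷ I ∷ O ∷ I ∷ [])) ⊕ (W (I ∷ O ∷ O ∷ I ∷ []) ⊕ W (O ∷ I ∷ I ∷ O ∷ []))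
               ⩽ (4 ⊗ tᴸ ⊕ c₄ᴸ) ⊕ (2 ⊗ tᴸ ⊕ c₄ᴸ)) ∷ [])
        (tt , tt)
        ( ≤-reflexive (sym (C .size≡)) ∷ 36t≤N ∷ N≥1 C ∷ 23q≤t ∷ bad ∷ bad′
        ∷ traceBound (I ∷ I ∷ I ∷ I ∷ []) ∷ traceBound (I ∷ I ∷ I ∷ O ∷ [])
        ∷ traceBound (I ∷ I ∷ O ∷ I ∷ []) ∷ traceBound (I ∷ O ∷ I ∷ I ∷ [])
        ∷ traceBound (O ∷ I ∷ I ∷ I ∷ []) ∷ few ∷ [])

      -- Without a heavy link, each crossing two-point trace has at most `4 t` members, and
      -- `opposite` treats the two complementary pairs of such traces. If neither pair obeys the
      -- better bound, each contains a trace with more than `2 t` members; two such traces share a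
      -- point and form a cherry.
      linked : Bad 0F 1F F → Bad 2F 3F F → Heavy 0F 2F F ⊎ Heavy 0F 3F F ⊎ Heavy 1F 2F F ⊎ Heavy 1F 3F F
      linked bad bad′
        with ≤-<-connex (codegree 0F 2F F) (4 * t) | ≤-<-connex (codegree 0F 3F F) (4 * t)
           | ≤-<-connex (codegree 1F 2F F) (4 * t) | ≤-<-connex (codegree 1F 3F F) (4 * t)
      ... | inj₂ h  | _       | _       | _       = inj₁ h
      ... | inj₁ _  | inj₂ h  | _       | _       = inj₂ (inj₁ h)
      ... | inj₁ _  | inj₁ _  | inj₂ h  | _       = inj₂ (inj₂ (inj₁ h))
      ... | inj₁ _  | inj₁ _  | inj₁ _  | inj₂ h  = inj₂ (inj₂ (inj₂ h))
      ... | inj₁ l₀₂ | inj₁ l₀₃ | inj₁ l₁₂ | inj₁ l₁₃ = ⊥-elim (cases (proj₂ p₁) (proj₂ p₂))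
        where
        crossing : (bs cs : Vec Bool 4) → T (disjoint bs cs) → 1 * choose (1 + m) k (suc (∣ cs ∣ + 0)) < size (trace cs F) →
          size (trace bs F) ≤ choose (1 + m) k (2 + (∣ bs ∣ + 0))
        crossing bs cs d = cross bs cs d 0
        once : ∀ {x} → c₃ < x → 1 * c₃ < x
        once = ≤-<-trans (≤-reflexive (*-identityˡ c₃))
        p₁ = opposite {w I O I O} {w O I O I}
          (≤-trans (size-trace-≤ (I ∷ O ∷ I ∷ O ∷ []) (link 0F 2F F)) l₀₂) (≤-trans (size-trace-≤ (O ∷ I ∷ O ∷ I ∷ []) (link 1F 3F F)) l₁₃)
          (λ big → crossing (O ∷ I ∷ O ∷ I ∷ []) (I ∷ O ∷ I ∷ O ∷ []) tt (once big))
          (λ big → crossing (I ∷ O ∷ I ∷ O ∷ []) (O ∷ I ∷ O ∷ I ∷ []) tt (once big))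
        p₂ = opposite {w I O O I} {w O I I O}
          (≤-trans (size-trace-≤ (I ∷ O ∷ O ∷ I ∷ []) (link 0F 3F F)) l₀₃) (≤-trans (size-trace-≤ (O ∷ I ∷ I ∷ O ∷ []) (link 1F 2F F)) l₁₂)
          (λ big → crossing (O ∷ I ∷ I ∷ O ∷ []) (I ∷ O ∷ O ∷ I ∷ []) tt (once big))
          (λ big → crossing (I ∷ O ∷ O ∷ I ∷ []) (O ∷ I ∷ I ∷ O ∷ []) tt (once big))
        cases : (w I O I O + w O I O I ≤ 2 * t + c₄ ⊎ 2 * t < w I O I O ⊎ 2 * t < w O I O I) →
                (w I O O I + w O I I O ≤ 2 * t + c₄ ⊎ 2 * t < w I O O I ⊎ 2 * t < w O I I O) → ⊥
        cases (inj₁ small) _ = linked-count bad bad′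
          (≤-trans (+-mono-≤ small (proj₁ p₂)) (≤-reflexive (+-comm (2 * t + c₄) (4 * t + c₄))))
        cases (inj₂ _) (inj₁ small) = linked-count bad bad′ (+-mono-≤ (proj₁ p₁) small)
        cases (inj₂ (inj₁ b)) (inj₂ (inj₁ b′)) = no-cherry∖ C {0F} {2F} {3F} (λ ()) (λ ()) (λ ())
          (≤-trans b (size-trace-≤ (I ∷ O ∷ I ∷ O ∷ []) (link∖ 0F 2F 3F F)))
          (≤-trans b′ (size-trace-≤ (I ∷ O ∷ O ∷ I ∷ []) (link∖ 0F 3F 2F F)))
        cases (inj₂ (inj₁ b)) (inj₂ (inj₂ b′)) = no-cherry∖ C {2F} {0F} {1F} (λ ()) (λ ()) (λ ())
          (≤-trans b (size-trace-≤ (I ∷ O ∷ I ∷ O ∷ []) (link∖ 2F 0F 1F F)))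
          (≤-trans b′ (size-trace-≤ (O ∷ I ∷ I ∷ O ∷ []) (link∖ 2F 1F 0F F)))
        cases (inj₂ (inj₂ b)) (inj₂ (inj₁ b′)) = no-cherry∖ C {3F} {1F} {0F} (λ ()) (λ ()) (λ ())
          (≤-trans b (size-trace-≤ (O ∷ I ∷ O ∷ I ∷ []) (link∖ 3F 1F 0F F)))
          (≤-trans b′ (size-trace-≤ (I ∷ O ∷ O ∷ I ∷ []) (link∖ 3F 0F 1F F)))
        cases (inj₂ (inj₂ b)) (inj₂ (inj₂ b′)) = no-cherry∖ C {1F} {3F} {2F} (λ ()) (λ ()) (λ ())
          (≤-trans b (size-trace-≤ (O ∷ I ∷ O ∷ I ∷ []) (link∖ 1F 3F 2F F)))
          (≤-trans b′ (size-trace-≤ (O ∷ I ∷ I ∷ O ∷ []) (link∖ 1F 2F 3F F)))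

      module _ (h : Heavy 0F 1F F) (stable : ∀ bs → Stable (trace {4} bs F)) where

        2c₃<w₁₁₀₀ : 2 * c₃ < w I I O O
        2c₃<w₁₁₀₀ = heavy-trace h

        light : ∀ {x y z} → x ≢ y → x ≢ z → y ≢ z → Heavy x y F → codegree∖ x z y F ≤ 2 * t
        light x≢y x≢z y≢z h = ≮⇒≥ (no-cherry∖ C x≢y x≢z y≢z (heavy∖ C x≢y x≢z y≢z h))

        -- By `spread` more than `N / 3`, so more than `12 t`, members miss 0. Of these at most
        -- `4 t` contain 1 and also 2 or 3, and at most `c₃ + 2 c₄ + c₅ = t + q` miss 1; the
        -- condition `spread` has `8 q / 3` to spare for the `q`.
        6t<w₀₁₀₀ : 6 * t < w O I O O
        6t<w₀₁₀₀ = ≰⇒> λ le → farkas ρ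
          ( (1 · con 1 ⊕ (3 ⊗ degᴸ 0F ⊕ 8 ⊗ qᴸ) ⩽ 2 ⊗ Nᴸ)
          ∷ (3 · Nᴸ ⩽ sizeᴸ)
          ∷ (1 · 36 ⊗ tᴸ ⩽ Nᴸ)
          ∷ (3 · W (O ∷ I ∷ O ∷ O ∷ []) ⩽ 6 ⊗ tᴸ)
          ∷ (3 · codeg∖ᴸ 1F 2F 0F ⩽ 2 ⊗ tᴸ)
          ∷ (3 · codeg∖ᴸ 1F 3F 0F ⩽ 2 ⊗ tᴸ)
          ∷ (3 · W (O ∷ O ∷ I ∷ O ∷ []) ⩽ c₄ᴸ)
          ∷ (3 · W (O ∷ O ∷ O ∷ I ∷ []) ⩽ c₄ᴸ)
          ∷ (3 · W (O ∷ O ∷ I ∷ I ∷ []) ⩽ c₅ᴸ)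
          ∷ (3 · W (O ∷ O ∷ O ∷ O ∷ []) ⩽ c₃ᴸ) ∷ [])
          (tt , tt)
          ( C .spread 0F ∷ ≤-reflexive (sym (C .size≡)) ∷ 36t≤N ∷ le
          ∷ light {1F} {0F} {2F} (λ ()) (λ ()) (λ ()) (heavy-sym 0F 1F F h)
          ∷ light {1F} {0F} {3F} (λ ()) (λ ()) (λ ()) (heavy-sym 0F 1F F h)
          ∷ cross (O ∷ O ∷ I ∷ O ∷ []) (I ∷ I ∷ O ∷ O ∷ []) tt 1 2c₃<w₁₁₀₀
          ∷ cross (O ∷ O ∷ O ∷ I ∷ []) (I ∷ I ∷ O ∷ O ∷ []) tt 1 2c₃<w₁₁₀₀
          ∷ cross (O ∷ O ∷ I ∷ I ∷ []) (I ∷ I ∷ O ∷ O ∷ []) tt 1 2c₃<w₁₁₀₀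
          ∷ cross (O ∷ O ∷ O ∷ O ∷ []) (I ∷ I ∷ O ∷ O ∷ []) tt 1 2c₃<w₁₁₀₀ ∷ [])

        -- The same count with 0 and 1 exchanged. The number `c₃` is the threshold of `cross-early`
        -- for a one-point trace and `r = 0`.
        c₃<w₁₀₀₀ : c₃ < w I O O O
        c₃<w₁₀₀₀ = ≰⇒> λ le → farkas ρ
          ( (1 · con 1 ⊕ (3 ⊗ degᴸ 1F ⊕ 8 ⊗ qᴸ) ⩽ 2 ⊗ Nᴸ)
          ∷ (3 · Nᴸ ⩽ sizeᴸ)
          ∷ (1 · 36 ⊗ tᴸ ⩽ Nᴸ)
          ∷ (3 · W (I ∷ O ∷ O ∷ O ∷ []) ⩽ c₃ᴸ)
          ∷ (3 · codeg∖ᴸ 0F 2F 1F ⩽ 2 ⊗ tᴸ)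
          ∷ (3 · codeg∖ᴸ 0F 3F 1F ⩽ 2 ⊗ tᴸ)
          ∷ (3 · W (O ∷ O ∷ I ∷ O ∷ []) ⩽ c₄ᴸ)
          ∷ (3 · W (O ∷ O ∷ O ∷ I ∷ []) ⩽ c₄ᴸ)
          ∷ (3 · W (O ∷ O ∷ I ∷ I ∷ []) ⩽ c₅ᴸ)
          ∷ (3 · W (O ∷ O ∷ O ∷ O ∷ []) ⩽ c₃ᴸ) ∷ [])
          (tt , tt)
          ( C .spread 1F ∷ ≤-reflexive (sym (C .size≡)) ∷ 36t≤N ∷ le
          ∷ light {0F} {1F} {2F} (λ ()) (λ ()) (λ ()) h
          ∷ light {0F} {1F} {3F} (λ ()) (λ ()) (λ ()) h
          ∷ cross (O ∷ O ∷ I ∷ O ∷ []) (I ∷ I ∷ O ∷ O ∷ []) tt 1 2c₃<w₁₁₀₀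
          ∷ cross (O ∷ O ∷ O ∷ I ∷ []) (I ∷ I ∷ O ∷ O ∷ []) tt 1 2c₃<w₁₁₀₀
          ∷ cross (O ∷ O ∷ I ∷ I ∷ []) (I ∷ I ∷ O ∷ O ∷ []) tt 1 2c₃<w₁₁₀₀
          ∷ cross (O ∷ O ∷ O ∷ O ∷ []) (I ∷ I ∷ O ∷ O ∷ []) tt 1 2c₃<w₁₁₀₀ ∷ [])

        -- Nearly all members with trace {1} contain the point 4, so {1,4} is a second heavy pair at 1.
        no-stable-heavy : ⊥
        no-stable-heavy = no-cherry C {1F} {0F} {4F} (λ ()) (λ ()) (λ ()) (heavy-sym 0F 1F F h)
          (≤-trans (≰⇒> λ le → farkas (t ∷ with₄ ∷ without₄ ∷ [])
              ( (1 · con 1 ⊕ 6 ⊗ var 0F ⩽ var 1F ⊕ var 2F)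
              ∷ (1 · var 1F ⩽ 4 ⊗ var 0F)
              ∷ (1 · var 2F ⩽ var 0F) ∷ [])
              (tt , tt) (6t<w₀₁₀₀ ∷ le ∷ without₄≤ ∷ []))
            (size-trace-≤ (O ∷ I ∷ O ∷ O ∷ I ∷ []) (link 1F 4F F)))
          where
          with₄ = size (trace {5} (O ∷ I ∷ O ∷ O ∷ I ∷ []) F)
          without₄ = size (trace {5} (O ∷ I ∷ O ∷ O ∷ O ∷ []) F)
          early₀ : ∀ A → trace (O ∷ I ∷ O ∷ O ∷ []) F A ≡ true → early 0 A ≡ true
          early₀ = cross-early 0 (stable (I ∷ O ∷ O ∷ O ∷ [])) (uniform-trace (I ∷ O ∷ O ∷ O ∷ []) (C .uniform))
            (cross-trace (I ∷ O ∷ O ∷ O ∷ []) (O ∷ I ∷ O ∷ O ∷ []) tt (C .intersecting)) c₃<w₁₀₀₀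
          -- Missing the point 4 lifts the walk from height 1 to 2, so `early₀` becomes `hits 2` on
          -- the remaining points.
          without₄≤ : without₄ ≤ t
          without₄≤ = ≤-trans (size-hits 2 (uniform-trace (O ∷ I ∷ O ∷ O ∷ O ∷ []) (C .uniform)) (λ A → early₀ (O ∷ A)))
            (≤-trans (choose-mono m k 3) (choose-mono (1 + m) k 3))

    no-disjoint-heavy : {F : Family (5 + m)} → Candidate F → {x y z w : V} →
      x ≢ y → x ≢ z → x ≢ w → y ≢ z → y ≢ w → z ≢ w → Heavy x y F → Heavy z w F → ⊥
    no-disjoint-heavy {F} C xy xz xw yz yw zw h h′ with select₄ xy xz xw yz yw zw
    ... | s , refl , refl , refl , refl = Four.no-disjoint-heavy (arrange-candidate s C)
      (subst (4 * t <_) (sym (codegree-arrange s F 0F 1F)) h)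
      (subst (4 * t <_) (sym (codegree-arrange s F 2F 3F)) h′)

    linked : {F : Family (5 + m)} → Candidate F → {x y z w : V} →
      x ≢ y → x ≢ z → x ≢ w → y ≢ z → y ≢ w → z ≢ w → Bad x y F → Bad z w F →
      Heavy x z F ⊎ Heavy x w F ⊎ Heavy y z F ⊎ Heavy y w F
    linked {F} C xy xz xw yz yw zw b b′ with select₄ xy xz xw yz yw zw
    ... | s , refl , refl , refl , refl = map (back 0F 2F) (map (back 0F 3F) (map (back 1F 2F) (back 1F 3F)))
      (Four.linked (arrange-candidate s C) (forth 0F 1F b) (forth 2F 3F b′))
      where
      back : ∀ x y → Heavy x y (F ∘ arrange s) → Heavy (position s x) (position s y) F
      back x y = subst (4 * t <_) (codegree-arrange s F x y)
      forth : ∀ x y → Bad (position s x) (position s y) F → Bad x y (F ∘ arrange s)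
      forth x y = subst (λ a → 3 * a ≤ N + 8 * q) (sym (avoiding-arrange s F x y))

    stable-no-heavy : {F : Family (5 + m)} → Candidate F → {x y z w : V} →
      x ≢ y → x ≢ z → x ≢ w → y ≢ z → y ≢ w → z ≢ w →
      StableOutside (x ∷ y ∷ z ∷ w ∷ []) F → Heavy x y F → ⊥
    stable-no-heavy {F} C xy xz xw yz yw zw st h with select₄ xy xz xw yz yw zw
    ... | s , refl , refl , refl , refl = Four.no-stable-heavy (arrange-candidate s C)
      (subst (4 * t <_) (sym (codegree-arrange s F 0F 1F)) h)
      (stable-trace λ {i} {j} i<j → stable-arrange s (λ eq → Finₚ.<⇒≢ i<j (Finₚ.↑ʳ-injective 4 i j eq))
        (st _ _ (position-mono-< s (s≤s (s≤s (s≤s (s≤s z≤n)))) (s≤s (s≤s (s≤s (s≤s i<j))))) (outside i) (outside j)))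
      where
      outside : ∀ i → All (position s (4 ↑ʳ i) ≢_) (position s 0F ∷ position s 1F ∷ position s 2F ∷ position s 3F ∷ [])
      outside i = apart (λ ()) ∷ apart (λ ()) ∷ apart (λ ()) ∷ apart (λ ()) ∷ []
        where
        apart : ∀ {y} → 4 ↑ʳ i ≢ y → position s (4 ↑ʳ i) ≢ position s y
        apart ne eq = ne (position-injective s eq)

    -- The members without the first point have walks that visit 0 from height 2, so there are at
    -- most `t` of them.
    size-early₀ : {G : Family (3 + m)} → UniformUpTo k 1 G → (∀ A → G A ≡ true → early 0 A ≡ true) →
      size (G ∘ (I ∷_)) ≤ 4 * t → size G ≤ 5 * t
    size-early₀ {G} u e le = ≤-trans (+-mono-≤ le (size-hits 2 (uniform-false {F = G} u) (λ A → e (O ∷ A))))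
      (≤-reflexive (+-comm (4 * t) t))

    -- The same with two points: members that miss both are left with a walk from height 2.
    size-early₁ : {G : Family (3 + m)} → UniformUpTo k 1 G → (∀ A → G A ≡ true → early 1 A ≡ true) →
      size (G ∘ (I ∷_)) ≤ 4 * t → size (G ∘ (λ A → O ∷ I ∷ A)) ≤ 4 * t → size G ≤ 9 * t
    size-early₁ {G} u e le le′ = ≤-trans
      (+-mono-≤ le (+-mono-≤ le′
        (≤-trans (size-hits 2 (uniform-trace (O ∷ O ∷ []) u) (λ A → e (O ∷ O ∷ A))) (choose-mono (1 + m) k 3))))
      (≤-reflexive (lemma t))
      where
      lemma : ∀ t → 4 * t + (4 * t + t) ≡ 9 * t
      lemma = solve-∀

    -- Traces on two points

    module Two {F : Family (5 + m)} (C : Candidate F) (bad : Bad 0F 1F F) (st : StableOutside (0F ∷ 1F ∷ []) F) where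

      ρ : Vec ℕ (pow 2 + 4)
      ρ = traces 2 F ++ (t ∷ q ∷ N ∷ total {3 + m} (λ _ → 0) ∷ [])

      tᴸ qᴸ Nᴸ zᴸ sizeᴸ : Lin (pow 2 + 4)
      tᴸ = other 2 0F
      qᴸ = other 2 1F
      Nᴸ = other 2 2F
      zᴸ = other 2 3F
      sizeᴸ = sumᴸ 2 W

      w : Bool → Bool → ℕ
      w a b = size (trace (a ∷ b ∷ []) F)

      stable : (bs : Vec Bool 2) → Stable (trace bs F)
      stable = stable-trace λ i<j → st _ _ (s≤s (s≤s i<j)) ((λ ()) ∷ (λ ()) ∷ []) ((λ ()) ∷ (λ ()) ∷ [])

      -- Stability outside {0,1} implies stability outside any four points that include 0 and 1, so
      -- `stable-no-heavy` applies to every pair among such four.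
      light : {x y z w : V} → x ≢ y → x ≢ z → x ≢ w → y ≢ z → y ≢ w → z ≢ w →
        (∀ {i : V} → All (i ≢_) (x ∷ y ∷ z ∷ w ∷ []) → All (i ≢_) (0F ∷ 1F ∷ [])) → codegree x y F ≤ 4 * t
      light xy xz xw yz yw zw sub = ≮⇒≥ (stable-no-heavy C xy xz xw yz yw zw (λ i j i<j oi oj → st i j i<j (sub oi) (sub oj)))

      light₀₁ : codegree 0F 1F F ≤ 4 * t
      light₀₁ = light {0F} {1F} {2F} {3F} (λ ()) (λ ()) (λ ()) (λ ()) (λ ()) (λ ())
        λ { (a ∷ b ∷ _) → a ∷ b ∷ [] }

      light₀₂ : codegree 0F 2F F ≤ 4 * t
      light₀₂ = light {0F} {2F} {1F} {3F} (λ ()) (λ ()) (λ ()) (λ ()) (λ ()) (λ ())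
        λ { (a ∷ _ ∷ b ∷ _) → a ∷ b ∷ [] }

      light₀₃ : codegree 0F 3F F ≤ 4 * t
      light₀₃ = light {0F} {3F} {1F} {2F} (λ ()) (λ ()) (λ ()) (λ ()) (λ ()) (λ ())
        λ { (a ∷ _ ∷ b ∷ _) → a ∷ b ∷ [] }

      light₁₂ : codegree 1F 2F F ≤ 4 * t
      light₁₂ = light {1F} {2F} {0F} {3F} (λ ()) (λ ()) (λ ()) (λ ()) (λ ()) (λ ())
        λ { (b ∷ _ ∷ a ∷ _) → a ∷ b ∷ [] }

      light₁₃ : codegree 1F 3F F ≤ 4 * t
      light₁₃ = light {1F} {3F} {0F} {2F} (λ ()) (λ ()) (λ ()) (λ ()) (λ ()) (λ ())
        λ { (b ∷ _ ∷ a ∷ _) → a ∷ b ∷ [] }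

      w₁₁≤4t : w I I ≤ 4 * t
      w₁₁≤4t = ≤-trans (size-trace-≤ (I ∷ I ∷ []) (link 0F 1F F)) light₀₁

      -- As {0,1} is bad, at least `(2 N − 8 q) / 3` members meet it, which is nearly `24 t`; the
      -- traces allow only `14 t + q`.
      too-few : w I O + w O I ≤ 10 * t + q → ⊥
      too-few few = farkas ρ
        ( (9 · Nᴸ ⩽ sizeᴸ)
        ∷ (3 · 3 ⊗ part 2 zᴸ (λ bs → not (lookup bs 0F) ∧ not (lookup bs 1F)) ⩽ Nᴸ ⊕ 8 ⊗ qᴸ)
        ∷ (9 · W (I ∷ I ∷ []) ⩽ 4 ⊗ tᴸ)
        ∷ (9 · W (I ∷ O ∷ []) ⊕ W (O ∷ I ∷ []) ⩽ 10 ⊗ tᴸ ⊕ qᴸ)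
        ∷ (5 · 36 ⊗ tᴸ ⩽ Nᴸ)
        ∷ (1 · con 1 ⩽ Nᴸ)
        ∷ (2 · 23 ⊗ qᴸ ⩽ tᴸ) ∷ [])
        (tt , tt)
        (≤-reflexive (sym (C .size≡)) ∷ bad ∷ w₁₁≤4t ∷ few ∷ 36t≤N ∷ N≥1 C ∷ 23q≤t ∷ [])

      -- If both traces without 0 were this small, nearly all members would contain 0. By Pascal's
      -- rule `t + q` is `choose (3 + m) k 3`, the threshold of `crossing` for the empty trace with
      -- `r = 1` and for a one-point trace with `r = 0`.
      large₀ : w O I ≤ t + q → t + q < w O O
      large₀ small = ≰⇒> λ le → farkas ρ
        ( (1 · con 1 ⊕ (3 ⊗ part 2 zᴸ (λ bs → lookup bs 0F) ⊕ 8 ⊗ qᴸ) ⩽ 2 ⊗ Nᴸ)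
        ∷ (3 · Nᴸ ⩽ sizeᴸ)
        ∷ (1 · 36 ⊗ tᴸ ⩽ Nᴸ)
        ∷ (3 · W (O ∷ I ∷ []) ⩽ tᴸ ⊕ qᴸ)
        ∷ (3 · W (O ∷ O ∷ []) ⩽ tᴸ ⊕ qᴸ) ∷ [])
        (tt , tt) (C .spread 0F ∷ ≤-reflexive (sym (C .size≡)) ∷ 36t≤N ∷ small ∷ le ∷ [])

      large₁ : w I O ≤ t + q → t + q < w O O
      large₁ small = ≰⇒> λ le → farkas ρ
        ( (1 · con 1 ⊕ (3 ⊗ part 2 zᴸ (λ bs → lookup bs 1F) ⊕ 8 ⊗ qᴸ) ⩽ 2 ⊗ Nᴸ)
        ∷ (3 · Nᴸ ⩽ sizeᴸ)
        ∷ (1 · 36 ⊗ tᴸ ⩽ Nᴸ)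
        ∷ (3 · W (I ∷ O ∷ []) ⩽ tᴸ ⊕ qᴸ)
        ∷ (3 · W (O ∷ O ∷ []) ⩽ tᴸ ⊕ qᴸ) ∷ [])
        (tt , tt) (C .spread 1F ∷ ≤-reflexive (sym (C .size≡)) ∷ 36t≤N ∷ small ∷ le ∷ [])

      crossing : (r : ℕ) (bs cs : Vec Bool 2) → T (disjoint bs cs) → choose (3 + m) k (2 + r + (∣ bs ∣ + 0)) < size (trace bs F) →
        ∀ A → trace cs F A ≡ true → early r A ≡ true
      crossing r bs cs d = cross-early r (stable bs) (uniform-trace bs (C .uniform)) (cross-trace bs cs d (C .intersecting))

      -- If both one-point traces exceed `t + q`, each makes the other `early 0` and hence at most
      -- `5 t`. If one does not, the empty trace does, which makes the other one-point trace
      -- `early 1` and hence at most `9 t`.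
      impossible : ⊥
      impossible with ≤-<-connex (w O I) (t + q) | ≤-<-connex (w I O) (t + q)
      ... | inj₁ small | _ = too-few (≤-trans (+-mono-≤ large small) (≤-reflexive (lemma t q)))
        where
        large : w I O ≤ 9 * t
        large = size-early₁ (uniform-trace (I ∷ O ∷ []) (C .uniform))
          (crossing 1 (O ∷ O ∷ []) (I ∷ O ∷ []) tt (large₀ small))
          (≤-trans (size-trace-≤ (I ∷ O ∷ I ∷ []) (link 0F 2F F)) light₀₂)
          (≤-trans (size-trace-≤ (I ∷ O ∷ O ∷ I ∷ []) (link 0F 3F F)) light₀₃)
        lemma : ∀ t q → 9 * t + (t + q) ≡ 10 * t + q
        lemma = solve-∀
      ... | inj₂ _ | inj₁ small = too-few (≤-trans (+-mono-≤ small large) (≤-reflexive (lemma t q)))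
        where
        large : w O I ≤ 9 * t
        large = size-early₁ (uniform-trace (O ∷ I ∷ []) (C .uniform))
          (crossing 1 (O ∷ O ∷ []) (O ∷ I ∷ []) tt (large₁ small))
          (≤-trans (size-trace-≤ (O ∷ I ∷ I ∷ []) (link 1F 2F F)) light₁₂)
          (≤-trans (size-trace-≤ (O ∷ I ∷ O ∷ I ∷ []) (link 1F 3F F)) light₁₃)
        lemma : ∀ t q → (t + q) + 9 * t ≡ 10 * t + q
        lemma = solve-∀
      ... | inj₂ big₀₁ | inj₂ big₁₀ = too-few (≤-trans
          (+-mono-≤
            (size-early₀ (uniform-trace (I ∷ O ∷ []) (C .uniform)) (crossing 0 (O ∷ I ∷ []) (I ∷ O ∷ []) tt big₀₁)
              (≤-trans (size-trace-≤ (I ∷ O ∷ I ∷ []) (link 0F 2F F)) light₀₂))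
            (size-early₀ (uniform-trace (O ∷ I ∷ []) (C .uniform)) (crossing 0 (I ∷ O ∷ []) (O ∷ I ∷ []) tt big₁₀)
              (≤-trans (size-trace-≤ (O ∷ I ∷ I ∷ []) (link 1F 2F F)) light₁₂)))
          (≤-trans (≤-reflexive (lemma t)) (m≤m+n (10 * t) q)))
        where
        lemma : ∀ t → 5 * t + 5 * t ≡ 10 * t
        lemma = solve-∀

    stable-not-bad : {F : Family (5 + m)} → Candidate F → {x y : V} → x ≢ y → Bad x y F →
      StableOutside (x ∷ y ∷ []) F → ⊥
    stable-not-bad {F} C x≢y bad st with select₂ x≢y
    ... | s , refl , refl = Two.impossible (arrange-candidate s C)
      (subst (λ a → 3 * a ≤ N + 8 * q) (sym (avoiding-arrange s F 0F 1F)) bad) st′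
      where
      beyond : {i : V} → All (i ≢_) (0F ∷ 1F ∷ []) → 2 ≤ Fin.toℕ i
      beyond {zero}        (ne ∷ _)     = ⊥-elim (ne refl)
      beyond {suc zero}    (_ ∷ ne ∷ _) = ⊥-elim (ne refl)
      beyond {suc (suc i)} _            = s≤s (s≤s z≤n)
      outside : {i : V} → All (i ≢_) (0F ∷ 1F ∷ []) → All (position s i ≢_) (position s 0F ∷ position s 1F ∷ [])
      outside (a ∷ b ∷ []) = (a ∘ position-injective s) ∷ (b ∘ position-injective s) ∷ []
      st′ : StableOutside (0F ∷ 1F ∷ []) (F ∘ arrange s)
      st′ i j i<j oi oj = stable-arrange s (Finₚ.<⇒≢ i<j) (st _ _ (position-mono-< s (beyond oi) i<j) (outside oi) (outside oj))

    -- In a stable intersecting family every walk from height 1 visits 0. Missing the first two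
    -- points lifts it to height 3, so at most `t + q` members do. Hence a family without unstable
    -- pairs also has a bad pair to feed to `stable-not-bad`.
    stable-bad : {F : Family (5 + m)} → Candidate F → Stable F → Bad 0F 1F F
    stable-bad {F} C st = ≮⇒≥ λ lt → farkas ρ
        ( (1 · con 1 ⊕ (Nᴸ ⊕ 8 ⊗ qᴸ) ⩽ 3 ⊗ part 2 zᴸ (λ bs → not (lookup bs 0F) ∧ not (lookup bs 1F)))
        ∷ (1 · 36 ⊗ tᴸ ⩽ Nᴸ)
        ∷ (3 · W (O ∷ O ∷ []) ⩽ tᴸ ⊕ qᴸ)
        ∷ (9 · zᴸ ⩽ con 0) ∷ [])
        (tt , tt)
        (lt ∷ 36t≤N ∷ size-hits 3 (uniform-trace (O ∷ O ∷ []) (C .uniform)) (λ A → hits₁ (O ∷ O ∷ A)) ∷ zero-sum (3 + m) ∷ [])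
      where
      ρ : Vec ℕ (pow 2 + 4)
      ρ = traces 2 F ++ (t ∷ q ∷ N ∷ total {3 + m} (λ _ → 0) ∷ [])
      tᴸ qᴸ Nᴸ zᴸ : Lin (pow 2 + 4)
      tᴸ = other 2 0F
      qᴸ = other 2 1F
      Nᴸ = other 2 2F
      zᴸ = other 2 3F
      hits₁ : ∀ A → F A ≡ true → hits 1 A ≡ true
      hits₁ A FA with hits 1 A in eq
      ... | true  = refl
      -- `A` plays both parts: `early 0` is `hits 1`, so its failure at `A` would yield `hits 2` at
      -- `A`.
      ... | false = trans (sym eq) (hits-weaken 1 A (stable-cross 0 st (C .intersecting) FA eq A FA))

    -- The third bad pair would be linked to {a, b} by a heavy pair, which with {a, c} gives two
    -- disjoint heavy pairs or a cherry.
    two-bad : {F : Family (5 + m)} → Extremal F → {a b c d : V} → a ≢ b → a ≢ c → a ≢ d → b ≢ c → b ≢ d → c ≢ d →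
      Bad a b F → Heavy a c F → ⊥
    two-bad {F} E {a} {b} {c} {d} ab ac ad bc bd cd bad h =
      [ third-bad , (λ st → stable-no-heavy C ac ab ad (≢-sym bc) cd bd st h) ]′ (another-bad E (a ∷ c ∷ b ∷ d ∷ []))
      where
      C = E .candidate
      third-bad : BadPairOutside (a ∷ c ∷ b ∷ d ∷ []) F → ⊥
      third-bad (e , f , ef , ea ∷ ec ∷ eb ∷ ed ∷ [] , fa ∷ fc ∷ fb ∷ fd ∷ [] , bad′) =
        [ no-cherry C ac (≢-sym ea) (≢-sym ec) h
        , [ no-cherry C ac (≢-sym fa) (≢-sym fc) h
        , [ no-disjoint-heavy C ac ab (≢-sym ea) (≢-sym bc) (≢-sym ec) (≢-sym eb) h
        , no-disjoint-heavy C ac ab (≢-sym fa) (≢-sym bc) (≢-sym fc) (≢-sym fb) h ]′ ]′ ]′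
        (linked C ab (≢-sym ea) (≢-sym fa) (≢-sym eb) (≢-sym fb) ef bad bad′)

    -- Disjoint bad pairs are collected greedily. If there are two, `linked` supplies a heavy pair
    -- between them, and the remaining point of the second pair is the `d` of `two-bad`.
    no-extremal : {F : Family (5 + m)} → Extremal F → ⊥
    no-extremal {F} E = [ first-bad , all-stable ]′ (another-bad E [])
      where
      C = E .candidate
      all-stable : StableOutside [] F → ⊥
      all-stable st = stable-not-bad C {0F} {1F} (λ ()) (stable-bad C (λ i<j → st _ _ i<j [] [])) (λ i j i<j _ _ → st i j i<j [] [])
      second-bad : ∀ {a b} → a ≢ b → Bad a b F → BadPairOutside (a ∷ b ∷ []) F → ⊥
      second-bad {a} {b} ab bad (c , d , cd , ca ∷ cb ∷ [] , da ∷ db ∷ [] , bad′) =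
        [ two-bad E ab (≢-sym ca) (≢-sym da) (≢-sym cb) (≢-sym db) cd bad
        , [ two-bad E ab (≢-sym da) (≢-sym ca) (≢-sym db) (≢-sym cb) (≢-sym cd) bad
        , [ two-bad E (≢-sym ab) (≢-sym cb) (≢-sym db) (≢-sym ca) (≢-sym da) cd (bad-sym a b F bad)
        , two-bad E (≢-sym ab) (≢-sym db) (≢-sym cb) (≢-sym da) (≢-sym ca) (≢-sym cd) (bad-sym a b F bad) ]′ ]′ ]′
        (linked C ab (≢-sym ca) (≢-sym da) (≢-sym cb) (≢-sym db) cd bad bad′)
      first-bad : BadPairOutside [] F → ⊥
      first-bad (a , b , ab , _ , _ , bad) =
        [ second-bad ab bad , stable-not-bad C ab bad ]′ (another-bad E (a ∷ b ∷ []))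

    no-candidate : {F : Family (5 + m)} → ¬ Candidate F
    no-candidate C = no-extremal (proj₂ (extremal C))

  -- Binomial coefficients

  open import Data.Nat.Combinatorics using (_C_; nCk+nC[k+1]≡[n+1]C[k+1])
  open import Data.Nat.Combinatorics.Specification using (k>n⇒nCk≡0)

  -- With `a = k − j` this is a C(m,a) = (m - a + 1) C(m,a - 1), free of subtractions.
  choose-absorb : ∀ m k j → m * choose m k (suc j) + suc j * choose m k (suc j) + j * choose m k j
    ≡ k * choose m k j + k * choose m k (suc j)
  choose-absorb zero k j = trans (+-comm (suc j * choose 0 k (suc j)) _) (cong₂ _+_ (weighted k j) (weighted k (suc j)))
    where
    weighted : ∀ k j → j * choose 0 k j ≡ k * choose 0 k j
    weighted zero    zero    = refl
    weighted zero    (suc j) = *-zeroʳ j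
    weighted (suc k) zero    = sym (*-zeroʳ k)
    weighted (suc k) (suc j) = cong₂ _+_ refl (weighted k j)
  -- By Pascal's rule the identity is the sum of those for `j` and `suc j` at `m`.
  choose-absorb (suc m) k j = trans
    (lemma m j (choose m k j) (choose m k (suc j)) (choose m k (suc (suc j))))
    (trans (cong₂ _+_ (choose-absorb m k j) (choose-absorb m k (suc j)))
      (lemma′ k (choose m k j) (choose m k (suc j)) (choose m k (suc (suc j)))))
    where
    lemma : ∀ m j a b c → suc m * (b + c) + suc j * (b + c) + j * (a + b)
      ≡ (m * b + suc j * b + j * a) + (m * c + suc (suc j) * c + suc j * b)
    lemma = solve-∀
    lemma′ : ∀ k a b c → (k * a + k * b) + (k * b + k * c) ≡ k * (a + b) + k * (b + c)
    lemma′ = solve-∀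

  choose-zero : ∀ m {k j} → k < j → choose m k j ≡ 0
  choose-zero zero    {zero}  {suc j} _        = refl
  choose-zero zero    {suc k} {suc j} (s≤s lt) = choose-zero zero lt
  choose-zero (suc m) lt = cong₂ _+_ (choose-zero m lt) (choose-zero m (m<n⇒m<1+n lt))

  choose-C : ∀ m j a → choose m (j + a) j ≡ m C a
  choose-C zero    j       zero    = trans (cong (λ i → choose 0 i j) (+-identityʳ j)) (diagonal j)
    where
    diagonal : ∀ j → choose 0 j j ≡ 1
    diagonal zero    = refl
    diagonal (suc j) = diagonal j
  choose-C zero    j       (suc a) = trans (off j) (sym (k>n⇒nCk≡0 {0} {suc a} (s≤s z≤n)))
    where
    off : ∀ j → choose 0 (j + suc a) j ≡ 0
    off zero    = refl
    off (suc j) = off j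
  choose-C (suc m) j       zero    = trans (cong₂ _+_ (choose-C m j 0)
    (choose-zero m (s≤s (≤-reflexive (+-identityʳ j))))) (+-identityʳ _)
  choose-C (suc m) j       (suc a) = trans
    (cong₂ _+_ (choose-C m j (suc a)) (trans (cong (λ i → choose m i (suc j)) (+-suc j a)) (choose-C m (suc j) a)))
    (trans (+-comm (m C suc a) (m C a)) (nCk+nC[k+1]≡[n+1]C[k+1] m a))

  choose-binom3 : ∀ n k → choose n k 3 ≡ binom3 (3 + n) k
  choose-binom3 n zero                = choose-zero n (s≤s z≤n)
  choose-binom3 n (suc zero)          = choose-zero n (s≤s (s≤s z≤n))
  choose-binom3 n (suc (suc zero))    = choose-zero n (s≤s (s≤s (s≤s z≤n)))
  choose-binom3 n (suc (suc (suc k))) = choose-C n 3 k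

  -- Absorption at `j = 3` reads (n + 1) q + 3 t = k t + k q with n = `5 + m`. Multiplied by 24, the
  -- last term is at most n q.
  23nq≤24kt : ∀ m k → 24 * k ≤ 5 + m → 23 * ((5 + m) * choose (2 + m) k 4) ≤ 24 * (k * choose (2 + m) k 3)
  23nq≤24kt m k 24k≤n = ≮⇒≥ λ lt → farkas ((5 + m) * q ∷ q ∷ t ∷ k * t ∷ k * q ∷ [])
    ( (1 · con 1 ⊕ 24 ⊗ var 3F ⩽ 23 ⊗ var 0F)
    ∷ (24 · (var 0F ⊕ var 1F) ⊕ 3 ⊗ var 2F ⩽ var 3F ⊕ var 4F)
    ∷ (1 · 24 ⊗ var 4F ⩽ var 0F) ∷ [])
    (tt , tt)
    ( lt
    ∷ ≤-reflexive (trans (lemma m q t) (choose-absorb (2 + m) k 3))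
    ∷ ≤-trans (≤-reflexive (sym (*-assoc 24 k q))) (*-monoˡ-≤ q 24k≤n) ∷ [])
    where
    t = choose (2 + m) k 3
    q = choose (2 + m) k 4
    lemma : ∀ m q t → ((5 + m) * q + q) + 3 * t ≡ (2 + m) * q + 4 * q + 3 * t
    lemma = solve-∀

  23q≤t : ∀ m k → 24 * k ≤ 5 + m → 23 * choose (2 + m) k 4 ≤ choose (2 + m) k 3
  23q≤t m k 24k≤n = *-cancelˡ-≤ (5 + m) (begin
    (5 + m) * (23 * q)  ≡⟨ lemma (5 + m) q ⟩
    23 * ((5 + m) * q)  ≤⟨ 23nq≤24kt m k 24k≤n ⟩
    24 * (k * t)        ≡⟨ sym (*-assoc 24 k t) ⟩
    24 * k * t          ≤⟨ *-monoˡ-≤ t 24k≤n ⟩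
    (5 + m) * t         ∎)
    where
    open ≤-Reasoning
    t = choose (2 + m) k 3
    q = choose (2 + m) k 4
    lemma : ∀ n q → n * (23 * q) ≡ 23 * (n * q)
    lemma = solve-∀

  8nq<3kN : ∀ m k N → 24 * k ≤ 5 + m → 1 ≤ k → 1 ≤ N → 36 * choose (2 + m) k 3 ≤ N →
    8 * ((5 + m) * choose (2 + m) k 4) < 3 * (k * N)
  8nq<3kN m k N 24k≤n k≥1 N≥1 36t≤N = ≰⇒> λ le → farkas ((5 + m) * q ∷ k * t ∷ k * N ∷ [])
    ( (23 · 3 ⊗ var 2F ⩽ 8 ⊗ var 0F)
    ∷ (8 · 23 ⊗ var 0F ⩽ 24 ⊗ var 1F)
    ∷ (6 · 36 ⊗ var 1F ⩽ var 2F)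
    ∷ (1 · con 1 ⩽ var 2F) ∷ [])
    (tt , tt)
    (le ∷ 23nq≤24kt m k 24k≤n ∷ ≤-trans (≤-reflexive (lemma k t)) (*-monoʳ-≤ k 36t≤N) ∷ *-mono-≤ k≥1 N≥1 ∷ [])
    where
    t = choose (2 + m) k 3
    q = choose (2 + m) k 4
    lemma : ∀ k t → 36 * (k * t) ≡ k * (36 * t)
    lemma = solve-∀

  -- Families given by lists

  _≟ₛ_ : (A B : Subset n) → Dec (A ≡ B)
  _≟ₛ_ = ≡-dec _≟ᵇ_

  size-singleton : (B : Subset n) → size (λ A → does (A ≟ₛ B)) ≡ 1
  size-singleton []                = refl
  size-singleton {suc n} (true ∷ B)  = trans (cong₂ _+_ (size-singleton B) (total-0 {n})) refl
  size-singleton {suc n} (false ∷ B) = cong₂ _+_ (total-0 {n}) (size-singleton B)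

  -- `G` is arbitrary so that the induction can delete the head of the list from it, and so that
  -- degrees are covered as well.
  size-list : (L : List (Subset n)) → Unique L → (G : Family n) →
    (∀ A → G A ≡ true → A ∈ L) → (∀ A → A ∈ L → G A ≡ true) → size G ≡ length L
  size-list {n} [] _ G to from = trans (total-cong (λ A → cong indicator (empty A))) (total-0 {n})
    where
    empty : ∀ A → G A ≡ false
    empty A with G A in eq
    ... | false = refl
    ... | true  = case to A eq of λ ()
  size-list {n} (B ∷ L) (B∉L ∷ unique) G to from = trans (size-split (λ A → does (A ≟ₛ B)) G)
    (cong₂ _+_ (trans (size-cong single) (size-singleton B)) (size-list L unique _ to′ from′))
    where
    single : ∀ A → does (A ≟ₛ B) ∧ G A ≡ does (A ≟ₛ B)
    single A with A ≟ₛ B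
    ... | yes refl = from A (here refl)
    ... | no _     = refl
    to′ : ∀ A → not (does (A ≟ₛ B)) ∧ G A ≡ true → A ∈ L
    to′ A h with A ≟ₛ B
    ... | no A≢B = case to A h of λ { (here eq) → ⊥-elim (A≢B eq) ; (there A∈L) → A∈L }
    from′ : ∀ A → A ∈ L → not (does (A ≟ₛ B)) ∧ G A ≡ true
    from′ A A∈L with A ≟ₛ B
    ... | yes refl = ⊥-elim (All.lookup B∉L A∈L refl)
    ... | no _     = from A (there A∈L)

  _∈?_ : (A : Subset n) (L : List (Subset n)) → Dec (A ∈ L)
  A ∈? L = any? (A ≟ₛ_) L

  family : List (Subset n) → Family n
  family L A = does (A ∈? L)

  family⁻ : (L : List (Subset n)) (A : Subset n) → family L A ≡ true → A ∈ L
  family⁻ L A h with A ∈? L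
  ... | yes A∈L = A∈L

  size-family : (L : List (Subset n)) → Unique L → size (family L) ≡ length L
  size-family L unique = size-list L unique (family L) (family⁻ L) (λ A → dec-true (A ∈? L))

  degree-family : (L : List (Subset n)) → Unique L → ∀ x → degreeOf x (family L) ≡ degree L x
  degree-family {n} L unique x = size-list (filter (x ∈ₛ?_) L) (filter⁺ (x ∈ₛ?_) unique) _ to from
    where
    to : ∀ A → lookup A x ∧ family L A ≡ true → A ∈ filter (x ∈ₛ?_) L
    to A h with lookup A x in eq
    ... | true = ∈-filter⁺ (x ∈ₛ?_) (family⁻ L A h) (lookup⇒[]= x A eq)
    from : ∀ A → A ∈ filter (x ∈ₛ?_) L → lookup A x ∧ family L A ≡ true
    from A A∈ with ∈-filter⁻ (x ∈ₛ?_) {xs = L} A∈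
    ... | A∈L , x∈A = cong₂ _∧_ ([]=⇒lookup x∈A) (dec-true (A ∈? L) A∈L)

  large-degree : (m k : ℕ) → 24 * k ≤ 5 + m → (L : List (Subset (5 + m))) → Unique L → Uniform k L → Intersecting L →
    36 * choose (2 + m) k 3 ≤ length L → ∃ λ x → 2 * length L ≤ 3 * degree L x + 8 * choose (2 + m) k 4
  large-degree m k 24k≤n L unique u int big
    with Finₚ.any? (λ x → 2 * length L ≤? 3 * degree L x + 8 * choose (2 + m) k 4)
  ... | yes found = found
  ... | no none = ⊥-elim (no-candidate (record
      { uniform      = λ A h → trans (+-identityʳ ∣ A ∣) (All.lookup u (family⁻ L A h))
      ; intersecting = λ A B hA hB → meet A B (int (family⁻ L A hA) (family⁻ L B hB))
      ; size≡        = size-family L unique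
      ; spread       = λ x → subst (λ d → 3 * d + 8 * choose (2 + m) k 4 < 2 * length L)
                         (sym (degree-family L unique x)) (≰⇒> (λ le → none (x , le))) }))
    where
    open Configuration m k (length L) (23q≤t m k 24k≤n) big
    meet : ∀ A B → Nonempty (A ∩ B) → Meet A B
    meet A B (x , x∈) with x∈p∩q⁻ A B x∈
    ... | x∈A , x∈B = x , []=⇒lookup x∈A , []=⇒lookup x∈B

  -- Rational numbers

  open import Data.Integer using (+_)
  import Data.Integer as ℤ
  import Data.Integer.Properties as ℤₚ
  open import Data.Rational using (ℚ; _/_; NonNegative) renaming (_+_ to _+ℚ_; _*_ to _*ℚ_; _-_ to _-ℚ_; _<_ to _<ℚ_; _≤_ to _≤ℚ_; -_ to -ℚ_)
  import Data.Rational as ℚ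
  import Data.Rational.Properties as ℚₚ
  import Data.Rational.Solver as ℚ-Solver
  import Data.Rational.Unnormalised as ℚᵘ
  import Data.Rational.Unnormalised.Properties as ℚᵘₚ

  toℚᵘ-toℚ : ∀ a → ℚ.toℚᵘ (toℚ a) ℚᵘ.≃ ℚᵘ.mkℚᵘ (+ a) 0
  toℚᵘ-toℚ a = ℚₚ.toℚᵘ-fromℚᵘ (ℚᵘ.mkℚᵘ (+ a) 0)

  toℚ-+ : ∀ a b → toℚ (a + b) ≡ toℚ a +ℚ toℚ b
  toℚ-+ a b = ℚₚ.toℚᵘ-injective (ℚᵘₚ.≃-trans (toℚᵘ-toℚ (a + b)) (ℚᵘₚ.≃-sym (ℚᵘₚ.≃-trans (ℚₚ.toℚᵘ-homo-+ (toℚ a) (toℚ b))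
    (ℚᵘₚ.≃-trans (ℚᵘₚ.+-cong (toℚᵘ-toℚ a) (toℚᵘ-toℚ b))
      (ℚᵘ.*≡* (cong (ℤ._* + 1) (trans (cong₂ ℤ._+_ (ℤₚ.*-identityʳ (+ a)) (ℤₚ.*-identityʳ (+ b))) refl)))))))

  toℚ-* : ∀ a b → toℚ (a * b) ≡ toℚ a *ℚ toℚ b
  toℚ-* a b = ℚₚ.toℚᵘ-injective (ℚᵘₚ.≃-trans (toℚᵘ-toℚ (a * b)) (ℚᵘₚ.≃-sym (ℚᵘₚ.≃-trans (ℚₚ.toℚᵘ-homo-* (toℚ a) (toℚ b))
    (ℚᵘₚ.≃-trans (ℚᵘₚ.*-cong (toℚᵘ-toℚ a) (toℚᵘ-toℚ b))
      (ℚᵘ.*≡* (cong (ℤ._* + 1) (sym (ℤₚ.pos-* a b))))))))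

  toℚ-mono-< : ∀ {a b} → a < b → toℚ a <ℚ toℚ b
  toℚ-mono-< {a} {b} lt = ℚₚ.toℚᵘ-cancel-< (ℚᵘₚ.<-respˡ-≃ (ℚᵘₚ.≃-sym (toℚᵘ-toℚ a)) (ℚᵘₚ.<-respʳ-≃ (ℚᵘₚ.≃-sym (toℚᵘ-toℚ b))
    (ℚᵘ.*<* (subst₂ ℤ._<_ (sym (ℤₚ.*-identityʳ (+ a))) (sym (ℤₚ.*-identityʳ (+ b))) (ℤ.+<+ lt)))))

  toℚ-cancel-≤ : ∀ a b → toℚ a ≤ℚ toℚ b → a ≤ b
  toℚ-cancel-≤ a b le = ≮⇒≥ λ lt → ℚₚ.<-irrefl refl (ℚₚ.<-≤-trans (toℚ-mono-< {b} {a} lt) le)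

  toℚ-nonNegative : ∀ a → NonNegative (toℚ a)
  toℚ-nonNegative zero    = _
  toℚ-nonNegative (suc a) = ℚₚ.pos⇒nonNeg (toℚ (suc a)) {{ℚ.positive (toℚ-mono-< {0} {suc a} (s≤s z≤n))}}

  module _ {X ε : ℚ} {{_ : NonNegative X}} where

    open ℚₚ.≤-Reasoning
    open ℚ-Solver.+-*-Solver

    24K≤X : ∀ {K} → ε ≤ℚ (+ 1) / 24 → K ≤ℚ X *ℚ ε → (+ 24) / 1 *ℚ K ≤ℚ X
    24K≤X {K} ε≤ K≤ = begin
      (+ 24) / 1 *ℚ K                      ≤⟨ ℚₚ.*-monoˡ-≤-nonNeg ((+ 24) / 1) K≤ ⟩
      (+ 24) / 1 *ℚ (X *ℚ ε)               ≤⟨ ℚₚ.*-monoˡ-≤-nonNeg ((+ 24) / 1) (ℚₚ.*-monoˡ-≤-nonNeg X ε≤) ⟩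
      (+ 24) / 1 *ℚ (X *ℚ ((+ 1) / 24))    ≡⟨ solve 1 (λ x → con ((+ 24) / 1) :* (x :* con ((+ 1) / 24)) := x) refl X ⟩
      X                                    ∎

    -- `X`, `K`, `Y`, `D` stand for `n`, `k`, the size and the degree. The claim is multiplied by
    -- `3 X`, whereupon `K ≤ X ε` turns the error `3 K Y` into the loss of `ε`.
    ratio-bound : ∀ {K Y D} {{_ : NonNegative Y}} → K ≤ℚ X *ℚ ε →
      (+ 2) / 1 *ℚ (X *ℚ Y) <ℚ (+ 3) / 1 *ℚ (X *ℚ D) +ℚ (+ 3) / 1 *ℚ (K *ℚ Y) →
      ((+ 2) / 3 -ℚ ε) *ℚ Y <ℚ D
    ratio-bound {K} {Y} {D} K≤ lt = ℚₚ.*-cancelˡ-<-nonNeg X (ℚₚ.*-cancelˡ-<-nonNeg ((+ 3) / 1) (begin-strict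
      (+ 3) / 1 *ℚ (X *ℚ (((+ 2) / 3 -ℚ ε) *ℚ Y))
        ≡⟨ solve 3 (λ x y e → con ((+ 3) / 1) :* (x :* ((con ((+ 2) / 3) :- e) :* y))
                           := con ((+ 2) / 1) :* (x :* y) :- con ((+ 3) / 1) :* (x :* e :* y)) refl X Y ε ⟩
      (+ 2) / 1 *ℚ (X *ℚ Y) -ℚ Z
        <⟨ ℚₚ.+-monoˡ-< (-ℚ Z) lt ⟩
      (+ 3) / 1 *ℚ (X *ℚ D) +ℚ (+ 3) / 1 *ℚ (K *ℚ Y) -ℚ Z
        ≤⟨ ℚₚ.+-monoˡ-≤ (-ℚ Z) (ℚₚ.+-monoʳ-≤ ((+ 3) / 1 *ℚ (X *ℚ D))
             (ℚₚ.*-monoˡ-≤-nonNeg ((+ 3) / 1) (ℚₚ.*-monoʳ-≤-nonNeg Y K≤))) ⟩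
      (+ 3) / 1 *ℚ (X *ℚ D) +ℚ Z -ℚ Z
        ≡⟨ solve 2 (λ a z → a :+ z :- z := a) refl ((+ 3) / 1 *ℚ (X *ℚ D)) Z ⟩
      (+ 3) / 1 *ℚ (X *ℚ D) ∎))
      where Z = (+ 3) / 1 *ℚ (X *ℚ ε *ℚ Y)

  24k≤n : ∀ n k {ε} → ε ≤ℚ (+ 1) / 24 → toℚ k ≤ℚ toℚ n *ℚ ε → 24 * k ≤ n
  24k≤n n k {ε} ε≤ k≤ = toℚ-cancel-≤ (24 * k) n (subst (_≤ℚ toℚ n) (sym (toℚ-* 24 k))
    (24K≤X {toℚ n} {ε} {{toℚ-nonNegative n}} {toℚ k} ε≤ k≤))

  degree-ratio : ∀ n k N d {ε} → toℚ k ≤ℚ toℚ n *ℚ ε → 2 * (n * N) < 3 * (n * d) + 3 * (k * N) →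
    ((+ 2) / 3 -ℚ ε) *ℚ toℚ N <ℚ toℚ d
  degree-ratio n k N d {ε} k≤ lt =
    ratio-bound {toℚ n} {ε} {{toℚ-nonNegative n}} {toℚ k} {toℚ N} {toℚ d} {{toℚ-nonNegative N}} k≤
      (subst₂ _<ℚ_ (homo 2 n N) (trans (toℚ-+ (3 * (n * d)) (3 * (k * N))) (cong₂ _+ℚ_ (homo 3 n d) (homo 3 k N)))
        (toℚ-mono-< {2 * (n * N)} {3 * (n * d) + 3 * (k * N)} lt))
    where
    homo : ∀ a b c → toℚ (a * (b * c)) ≡ toℚ a *ℚ (toℚ b *ℚ toℚ c)
    homo a b c = trans (toℚ-* a (b * c)) (cong (toℚ a *ℚ_) (toℚ-* b c))

  -- Multiplied by `n`, the error `8 q` of `large-degree` drops below `3 k N`, the form that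
  -- `ratio-bound` takes.
  scale-degree : ∀ n k N d q → 2 * N ≤ 3 * d + 8 * q → 8 * (n * q) < 3 * (k * N) → 2 * (n * N) < 3 * (n * d) + 3 * (k * N)
  scale-degree n k N d q le lt = begin-strict
    2 * (n * N)                ≡⟨ lemma n N ⟩
    n * (2 * N)                ≤⟨ *-monoʳ-≤ n le ⟩
    n * (3 * d + 8 * q)        ≡⟨ lemma′ n d q ⟩
    3 * (n * d) + 8 * (n * q)  <⟨ +-monoʳ-< (3 * (n * d)) lt ⟩
    3 * (n * d) + 3 * (k * N)  ∎
    where
    open ≤-Reasoning
    lemma : ∀ n N → 2 * (n * N) ≡ n * (2 * N)
    lemma = solve-∀
    lemma′ : ∀ n d q → n * (3 * d + 8 * q) ≡ 3 * (n * d) + 8 * (n * q)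
    lemma′ = solve-∀

  relative-degree-5+m : (m k : ℕ) {ε : ℚ} → 24 * k ≤ 5 + m → k ≥ 1 → toℚ k ≤ℚ toℚ (5 + m) *ℚ ε →
    (F : List (Subset (5 + m))) → Unique F → Uniform k F → Intersecting F →
    length F ≥ 1 → length F ≥ 36 * binom3 (5 + m) k →
    ∃ λ i → ((+ 2) / 3 -ℚ ε) *ℚ toℚ (length F) <ℚ toℚ (degree F i)
  relative-degree-5+m m k 24k≤ k≥1 k≤nε F unique u int F≥1 F≥36 = conclude (large-degree m k 24k≤ F unique u int big)
    where
    big : 36 * choose (2 + m) k 3 ≤ length F
    big = subst (λ c → 36 * c ≤ length F) (sym (choose-binom3 (2 + m) k)) F≥36
    conclude : (∃ λ x → 2 * length F ≤ 3 * degree F x + 8 * choose (2 + m) k 4) → _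
    conclude (x , le) = x , degree-ratio (5 + m) k (length F) (degree F x) k≤nε
      (scale-degree (5 + m) k (length F) (degree F x) (choose (2 + m) k 4) le (8nq<3kN m k (length F) 24k≤ k≥1 F≥1 big))

  relative-degree : (n k : ℕ) {ε : ℚ} → ε ≤ℚ (+ 1) / 24 → k ≥ 1 → toℚ k ≤ℚ toℚ n *ℚ ε →
    (F : List (Subset n)) → Unique F → Uniform k F → Intersecting F →
    length F ≥ 1 → length F ≥ 36 * binom3 n k →
    ∃ λ i → ((+ 2) / 3 -ℚ ε) *ℚ toℚ (length F) <ℚ toℚ (degree F i)
  relative-degree n k {ε} ε≤ k≥1 k≤nε = go n (m≤n⇒∃[o]m+o≡n 5≤n) 24k≤ k≤nε
    where
    24k≤ : 24 * k ≤ n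
    24k≤ = 24k≤n n k ε≤ k≤nε
    -- Since `k` is positive, `24 k ≤ n` provides far more than the five points needed.
    5≤n : 5 ≤ n
    5≤n = ≤-trans (≤-trans (m≤m+n 5 19) (*-monoʳ-≤ 24 k≥1)) 24k≤
    go : ∀ n → (∃ λ m → 5 + m ≡ n) → 24 * k ≤ n → toℚ k ≤ℚ toℚ n *ℚ ε →
      (F : List (Subset n)) → Unique F → Uniform k F → Intersecting F →
      length F ≥ 1 → length F ≥ 36 * binom3 n k →
      ∃ λ i → ((+ 2) / 3 -ℚ ε) *ℚ toℚ (length F) <ℚ toℚ (degree F i)
    go _ (m , refl) 24k≤ k≤nε = relative-degree-5+m m k 24k≤ k≥1 k≤nε

open import Defs
open import Data.Nat using (ℕ; _≥_; _*_)
open import Data.Fin using (Fin)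
open import Data.Fin.Subset using (Subset)
open import Data.List using (List; length)
open import Data.List.Relation.Unary.Unique.Propositional using (Unique)
open import Data.Product using (∃)
open import Data.Integer using (+_)
open import Data.Rational using (ℚ; 0ℚ; _<_; _≤_; _/_; _-_) renaming (_*_ to _*ℚ_)

theorem1p8 : (ε : ℚ) → 0ℚ < ε → ε ≤ (+ 1) / 24 →
    (n k : ℕ) → n ≥ 1 → k ≥ 1 → toℚ k ≤ toℚ n *ℚ ε →
    (F : List (Subset n)) → Unique F → Uniform k F → Intersecting F →
    length F ≥ 1 →
    length F ≥ 36 * binom3 n k →
    ∃ λ (i : Fin n) → ((+ 2) / 3 - ε) *ℚ toℚ (length F) < toℚ (degree F i)
theorem1p8 ε _ ε≤ n k _ k≥1 k≤nε = RelativeDegree.relative-degree n k ε≤ k≥1 k≤nε
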